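{- Let $G=(V,E)$ be a Hamiltonian cubic graph not isomorphic to $H_1$ or $H_2$. Then there exists a connected proportionally dense subgraph of size $\left\lfloor\frac{2\cdot|V|+1}{3}\right\rfloor$ in $G$.
   Context: All graphs are finite, simple, undirected and connected. A cubic graph is a 3-regular graph. For a graph $G=(V,E)$, $d(v)$ is the degree of $v\in V$, $N(v)$ its set of neighbors, and for $S\subset V$, $d_S(v)=|N(v)\cap S|$, $\overline{S}=V\setminus S$, and $G[S]$ is the subgraph induced by $S$. For $S\subset V$ with $2\le |S|<|V|$, the induced subgraph $G[S]$ is a proportionally dense subgraph (PDS) if every $u\in S$ satisfies $\frac{d_S(u)}{|S|-1}\ge \frac{d(u)}{|V|-1}$ (equivalently $\frac{d_S(u)}{|S|-1}\ge\frac{d_{\overline{S}}(u)}{|\overline{S}|}$). Its size is $|S|$. It is a connected PDS if $G[S]$ is connected. $H_1$ and $H_2$ are the following cubic graphs on the vertex set $\{0,1,\dots,7\}$. Both contain the Hamiltonian cycle $(0,1,2,3,4,5,6,7)$, i.e. the edges $\{i,i+1\}$ for $0\le i\le 6$ and $\{7,0\}$. In addition, $H_1$ has the edges $\{0,2\},\{1,3\},\{4,6\},\{5,7\}$, and $H_2$ has the edges $\{0,3\},\{1,6\},\{2,5\},\{4,7\}$. -}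

module Defs where

open import Data.Bool using (true)
open import Data.Fin using (Fin; toℕ; #_)
open import Data.Fin.Permutation using (Permutation; Permutation′; _⟨$⟩ʳ_)
open import Data.Fin.Properties using (nonZeroIndex; _≟_)
open import Data.Fin.Subset using (Subset; _∈_; _∉_; _∩_; ∣_∣)
open import Data.Integer using (+_)
open import Data.List using (List; []; _∷_; _++_; map; allFin)
import Data.List.Membership.DecPropositional as DecMembership
import Data.List.Membership.Propositional as List
open import Data.List.Relation.Unary.All using (All; all?; lookup)
open import Data.Nat using (ℕ; suc; _∸_; _≤_; _<_; NonZero; >-nonZero)
open import Data.Nat.DivMod using (_mod_)
open import Data.Nat.Properties using (m<n⇒0<n∸m; <-trans)
open import Data.Product using (Σ-syntax; ∃; _×_; _,_; proj₁; proj₂; uncurry)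
open import Data.Product.Properties using (≡-dec)
import Data.Rational.Unnormalised as ℚᵘ
open import Data.Sum using (_⊎_; inj₁; inj₂; swap)
open import Data.Vec using (tabulate)
open import Data.Vec.Properties using (lookup∘tabulate; lookup⇒[]=; []=⇒lookup)
open import Function using (_on_)
open import Function.Bundles using (_⇔_)
open import Level using (0ℓ)
open import Relation.Binary.Core using (Rel)
open import Relation.Binary.Construct.Closure.ReflexiveTransitive using (Star)
open import Relation.Binary.PropositionalEquality using (_≡_; _≢_; refl; sym; trans)
open import Relation.Nullary using (Dec; yes; does; ¬_)
open import Relation.Nullary.Decidable using (dec-true; True; toWitness; _⊎-dec_; ¬?)

record Graph (n : ℕ) : Set where
  field
    N        : Fin n → Subset n
    N-sym    : ∀ {u v} → v ∈ N u → u ∈ N v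
    N-irrefl : ∀ {v} → v ∉ N v

  Adj : Rel (Fin n) 0ℓ
  Adj u v = v ∈ N u

  d : Fin n → ℕ
  d v = ∣ N v ∣

  d[_] : Subset n → Fin n → ℕ
  d[ S ] v = ∣ N v ∩ S ∣

  -- The adjacency relation of G[S], whose vertices are the elements of S.
  Induced : (S : Subset n) → Rel (∃ (_∈ S)) 0ℓ
  Induced S = Adj on proj₁

open Graph public

ConnectedRel : {A : Set} → Rel A 0ℓ → Set
ConnectedRel R = ∀ u v → Star R u v

Connected : ∀ {n} → Graph n → Set
Connected G = ConnectedRel (Adj G)

Cubic : ∀ {n} → Graph n → Set
Cubic G = ∀ v → d G v ≡ 3

-- Successor modulo n.
next : ∀ {n} → Fin n → Fin n
next {n} i = (suc (toℕ i) mod n) {{nonZeroIndex i}}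

Hamiltonian : ∀ {n} → Graph n → Set
Hamiltonian {n} G =
  3 ≤ n × Σ[ c ∈ Permutation′ n ] (∀ i → Adj G (c ⟨$⟩ʳ i) (c ⟨$⟩ʳ next i))

infix 4 _≅_

_≅_ : ∀ {m n} → Graph m → Graph n → Set
_≅_ {m} {n} G H =
  Σ[ σ ∈ Permutation m n ] (∀ u v → Adj G u v ⇔ Adj H (σ ⟨$⟩ʳ u) (σ ⟨$⟩ʳ v))

record PDS {n : ℕ} (G : Graph n) (S : Subset n) : Set where
  field
    2≤∣S∣ : 2 ≤ ∣ S ∣
    ∣S∣<n : ∣ S ∣ < n

  instance
    ∣S∣∸1≢0 : NonZero (∣ S ∣ ∸ 1)
    ∣S∣∸1≢0 = >-nonZero (m<n⇒0<n∸m 2≤∣S∣)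

    n∸1≢0 : NonZero (n ∸ 1)
    n∸1≢0 = >-nonZero (m<n⇒0<n∸m (<-trans 2≤∣S∣ ∣S∣<n))

  field
    dense : ∀ {u} → u ∈ S →
            (+ d[_] G S u) ℚᵘ./ (∣ S ∣ ∸ 1) ℚᵘ.≥ (+ d G u) ℚᵘ./ (n ∸ 1)

ConnectedPDS : ∀ {n} → Graph n → Subset n → Set
ConnectedPDS G S = PDS G S × ConnectedRel (Induced G S)

module _ {n : ℕ} (es : List (Fin n × Fin n)) where

  open DecMembership (≡-dec (_≟_ {n}) (_≟_ {n})) using (_∈?_)

  private
    Joined : Rel (Fin n) 0ℓ
    Joined u v = (u , v) List.∈ es ⊎ (v , u) List.∈ es

    joined? : ∀ u v → Dec (Joined u v)
    joined? u v = ((u , v) ∈? es) ⊎-dec ((v , u) ∈? es)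

    nbrs : Fin n → Subset n
    nbrs u = tabulate (λ v → does (joined? u v))

    ∈nbrs⁺ : ∀ {u v} → Joined u v → v ∈ nbrs u
    ∈nbrs⁺ {u} {v} j = lookup⇒[]= v (nbrs u)
      (trans (lookup∘tabulate _ v) (dec-true (joined? u v) j))

    dec-true⁻¹ : ∀ {A : Set} (a? : Dec A) → does a? ≡ true → A
    dec-true⁻¹ (yes a) _ = a

    ∈nbrs⁻ : ∀ {u v} → v ∈ nbrs u → Joined u v
    ∈nbrs⁻ {u} {v} v∈ = dec-true⁻¹ (joined? u v)
      (trans (sym (lookup∘tabulate _ v)) ([]=⇒lookup v∈))

    loopless : All (uncurry _≢_) es → ∀ {v} → ¬ Joined v v
    loopless ne (inj₁ e) = lookup ne e refl
    loopless ne (inj₂ e) = lookup ne e refl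

  fromEdges : {True (all? (λ e → ¬? (proj₁ e ≟ proj₂ e)) es)} → Graph n
  fromEdges {ne} = record
    { N        = nbrs
    ; N-sym    = λ v∈ → ∈nbrs⁺ (swap (∈nbrs⁻ v∈))
    ; N-irrefl = λ v∈ → loopless (toWitness ne) (∈nbrs⁻ v∈)
    }

cycle₈ : List (Fin 8 × Fin 8)
cycle₈ = map (λ i → i , next i) (allFin 8)

H₁ H₂ : Graph 8
H₁ = fromEdges (cycle₈ ++ (# 0 , # 2) ∷ (# 1 , # 3) ∷ (# 4 , # 6) ∷ (# 5 , # 7) ∷ [])
H₂ = fromEdges (cycle₈ ++ (# 0 , # 3) ∷ (# 1 , # 6) ∷ (# 2 , # 5) ∷ (# 4 , # 7) ∷ [])

-- Let k = ⌊(2n + 1)/3⌋.  Since 3(k − 1) ≤ 2(n − 1), a connected induced subgraph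
-- on k vertices with minimum degree 2 is enough.  An arc of k consecutive vertices
-- of the Hamiltonian cycle works as soon as the chords at its two ends stay inside.
-- If no arc works, then every chord spans at most n − k steps in one of its two
-- directions, which splits the vertices into as many tails as heads, and the
-- pattern of tails is invariant under a rotation by k − 1, hence by 3, 4 or 2
-- according to n mod 6.  Period 3 contradicts the balance of tails and heads.
-- Otherwise tails and heads alternate singly or in pairs, and an arc of k + 1
-- vertices with one inner vertex removed works, unless the chords are
-- those of H₁ or H₂.

module Submission where

open import Defs
import Algebra.Properties.CommutativeMonoid.Sum as Sum
open import Data.Bool using (Bool; true; false; not)
open import Data.Bool.Properties using (¬-not; not-¬; not-involutive)
open import Data.Fin using (Fin; zero; suc; toℕ; fromℕ<)
open import Data.Fin.Patterns using (0F; 1F; 2F; 3F; 4F; 5F; 6F; 7F)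
open import Data.Fin.Permutation using (Permutation; permutation; _⟨$⟩ʳ_; _⟨$⟩ˡ_; inverseˡ; inverseʳ)
open import Data.Fin.Properties using (toℕ<n; toℕ-injective; toℕ-fromℕ<; fromℕ<-toℕ; fromℕ<-cong; all?) renaming (_≟_ to _≟ᶠ_)
open import Data.Fin.Subset using (Subset; _∈_; _∉_; _∪_; _-_; ∣_∣; ⊥; ⁅_⁆; inside; outside; Nonempty)
open import Data.Fin.Subset.Properties using (x∈p∧x≢y⇒x∈p-y; p─q⊆p; x∈p⇒∣p-x∣<∣p∣; nonempty?; _∈?_; Empty-unique; ∣⊥∣≡0; ∉⊥; ∪-identityʳ; x∈p∪q⁺; x∈p∪q⁻; x∈⁅x⁆; x∈⁅y⁆⇒x≡y; x∈p∩q⁺; p─⊥≡p)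
import Data.Integer as ℤ
import Data.Integer.Properties as ℤ
open import Data.List using ([]; _∷_)
open import Data.Nat hiding (∣_-_∣)
open import Data.Nat.Divisibility using (divides)
open import Data.Nat.DivMod using (_/_; _%_; _mod_; m%n<n; [m+n]%n≡m%n; [m+kn]%n≡m%n; %-distribˡ-+; m%n%n≡m%n; m<n⇒m%n≡m; m<n⇒m/n≡0; m*n/n≡m; +-distrib-/-∣ʳ; _divMod_; DivMod; result; m≡m%n+[m/n]*n; m/n*n≤m)
open import Data.Nat.Properties
open import Data.Nat.Tactic.RingSolver using (solve)
open import Data.Product using (∃-syntax; _×_; _,_; proj₁; proj₂)
import Data.Rational.Unnormalised as ℚᵘ
open import Data.Sum using (_⊎_; inj₁; inj₂; [_,_]′)
open import Data.Vec as Vec using (here; there)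
open import Data.Vec.Properties.WithK using ([]=-irrelevant)
open import Function using (_∘_; id)
open import Function.Bundles using (_⇔_; mk⇔; Equivalence)
open import Relation.Binary.Construct.Closure.ReflexiveTransitive using (Star; ε; _◅_; _◅◅_; reverse)
open import Relation.Binary.Definitions using (tri<; tri≈; tri>)
open import Relation.Binary.PropositionalEquality using (_≡_; _≢_; refl; sym; trans; cong; cong₂; subst; subst₂; module ≡-Reasoning)
open import Relation.Nullary using (¬_; Dec; yes; no; does; contradiction)
open import Relation.Nullary.Decidable using (dec-true; dec-false; _×-dec_; _⊎-dec_; _→-dec_; toWitness)

-- Why the pattern of tails is invariant: if the chord at the first vertex of an arc of k vertices
-- stays inside and the arc still fails, the chord at its last vertex leaves the arc, so it leads at
-- most n - k steps onward. As n < 2k, that chord stays inside the arc of k vertices that starts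
-- there, and the argument repeats k - 1 steps further on. An arc with a gap has four ends. The
-- chords at the two neighbours of the gap cannot end in it, since they have length at least 2 in
-- both directions. The obstacle is a chord from an outer end to the removed vertex. From the first
-- vertex it is excluded by the pattern of tails or by its length; from the last vertex it means
-- that the chord at the removed vertex has one particular length. Hence the case distinctions on
-- single chord lengths, with another way to split the arcs for each exceptional length. On 8
-- vertices all chord lengths are forced instead.

private variable
  n : ℕ

-- Cardinalities of finite subsets

∣p∣≡1+∣p-x∣ : ∀ {p : Subset n} {x} → x ∈ p → ∣ p ∣ ≡ suc ∣ p - x ∣
∣p∣≡1+∣p-x∣ {p = inside Vec.∷ p} here = cong (suc ∘ ∣_∣) (sym (p─⊥≡p p))
∣p∣≡1+∣p-x∣ {p = inside Vec.∷ p} (there x∈p) = cong suc (∣p∣≡1+∣p-x∣ x∈p)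
∣p∣≡1+∣p-x∣ {p = outside Vec.∷ p} (there x∈p) = ∣p∣≡1+∣p-x∣ x∈p

∣p∪⁅x⁆∣≡1+∣p∣ : ∀ {p : Subset n} {x} → x ∉ p → ∣ p ∪ ⁅ x ⁆ ∣ ≡ suc ∣ p ∣
∣p∪⁅x⁆∣≡1+∣p∣ {p = inside Vec.∷ p} {zero} x∉p = contradiction here x∉p
∣p∪⁅x⁆∣≡1+∣p∣ {p = outside Vec.∷ p} {zero} x∉p = cong (suc ∘ ∣_∣) (∪-identityʳ p)
∣p∪⁅x⁆∣≡1+∣p∣ {p = inside Vec.∷ p} {suc x} x∉p = cong suc (∣p∪⁅x⁆∣≡1+∣p∣ (x∉p ∘ there))
∣p∪⁅x⁆∣≡1+∣p∣ {p = outside Vec.∷ p} {suc x} x∉p = ∣p∪⁅x⁆∣≡1+∣p∣ (x∉p ∘ there)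

∣p∣≡1+m⇒Nonempty : ∀ {p : Subset n} {m} → ∣ p ∣ ≡ suc m → Nonempty p
∣p∣≡1+m⇒Nonempty {n} {p} eq with nonempty? p
... | yes ne = ne
... | no e = contradiction (trans (sym eq) (trans (cong ∣_∣ (Empty-unique e)) (∣⊥∣≡0 n))) λ ()

x∈p∧y∈p⇒2≤∣p∣ : ∀ {p : Subset n} {x y} → x ∈ p → y ∈ p → x ≢ y → 2 ≤ ∣ p ∣
x∈p∧y∈p⇒2≤∣p∣ x∈p y∈p x≢y = ≤-trans
  (s≤s (≤-<-trans z≤n (x∈p⇒∣p-x∣<∣p∣ (x∈p∧x≢y⇒x∈p-y x∈p x≢y)))) (x∈p⇒∣p-x∣<∣p∣ y∈p)

x∉p-x : ∀ {p : Subset n} {x} → x ∉ p - x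
x∉p-x {p = inside Vec.∷ p} {zero} ()
x∉p-x {p = outside Vec.∷ p} {zero} ()
x∉p-x {p = inside Vec.∷ p} {suc x} (there x∈) = x∉p-x x∈
x∉p-x {p = outside Vec.∷ p} {suc x} (there x∈) = x∉p-x x∈

-- Applied to the neighbourhood of a vertex in a cubic graph, with `x` and `y` its cycle neighbours,
-- this yields the chord and shows that no other edge is left.
third-element : ∀ {p : Subset n} {x y} → ∣ p ∣ ≡ 3 → x ∈ p → y ∈ p → x ≢ y →
  ∃[ z ] z ∈ p × z ≢ x × z ≢ y × (∀ w → w ∈ p → w ≡ x ⊎ w ≡ y ⊎ w ≡ z)
third-element {n} {p} {x} {y} ∣p∣≡3 x∈p y∈p x≢y = conclude (∣p∣≡1+m⇒Nonempty ∣p-x-y∣≡1)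
  where
  ∣p-x-y∣≡1 : ∣ p - x - y ∣ ≡ 1
  ∣p-x-y∣≡1 = suc-injective (suc-injective (sym (trans (sym ∣p∣≡3)
    (trans (∣p∣≡1+∣p-x∣ x∈p) (cong suc (∣p∣≡1+∣p-x∣ (x∈p∧x≢y⇒x∈p-y y∈p (x≢y ∘ sym))))))))

  conclude : Nonempty (p - x - y) → _
  conclude (z , z∈) = z , p─q⊆p _ _ (p─q⊆p _ _ z∈)
    , (λ { refl → x∉p-x {p = p} (p─q⊆p (p - x) ⁅ y ⁆ z∈) })
    , (λ { refl → x∉p-x {p = p - x} z∈ })
    , only
    where
    only : ∀ w → w ∈ p → w ≡ x ⊎ w ≡ y ⊎ w ≡ z
    only w w∈p with w ≟ᶠ x | w ≟ᶠ y | w ≟ᶠ z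
    ... | yes w≡x | _ | _ = inj₁ w≡x
    ... | no _ | yes w≡y | _ = inj₂ (inj₁ w≡y)
    ... | no _ | no _ | yes w≡z = inj₂ (inj₂ w≡z)
    ... | no w≢x | no w≢y | no w≢z = contradiction
      (trans (sym ∣p-x-y∣≡1) (∣p∣≡1+∣p-x∣ z∈))
      λ 1≡1+ → <-irrefl (suc-injective 1≡1+) (≤-<-trans z≤n (x∈p⇒∣p-x∣<∣p∣
        (x∈p∧x≢y⇒x∈p-y (x∈p∧x≢y⇒x∈p-y (x∈p∧x≢y⇒x∈p-y w∈p w≢x) w≢y) w≢z)))

-- The vertices of a Hamiltonian cycle are indexed by all of ℕ, periodically, so
-- that the chord at v m is a number ℓ m : it joins v m to v (m + ℓ m).
record ChordedCycle {n : ℕ} (G : Graph n) : Set where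
  field
    v            : ℕ → Fin n
    ℓ            : ℕ → ℕ
    v-periodic   : ∀ m → v (m + n) ≡ v m
    v-injective  : ∀ m {i j} → i < n → j < n → v (m + i) ≡ v (m + j) → i ≡ j
    v-surjective : ∀ m u → ∃[ j ] j < n × v (m + j) ≡ u
    step         : ∀ m → Adj G (v m) (v (suc m))
    chord        : ∀ m → Adj G (v m) (v (m + ℓ m))
    2≤ℓ          : ∀ m → 2 ≤ ℓ m
    ℓ+2≤n        : ∀ m → ℓ m + 2 ≤ n
    neighbours   : ∀ m {j} → j < n → Adj G (v m) (v (m + j)) → j ≡ 1 ⊎ suc j ≡ n ⊎ j ≡ ℓ m

-- Positions modulo n and chord lengths

%-cong-+ʳ : ∀ {a b} x n .{{_ : NonZero n}} → a % n ≡ b % n → (a + x) % n ≡ (b + x) % n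
%-cong-+ʳ {a} {b} x n eq = trans (%-distribˡ-+ a x n)
  (trans (cong (λ r → (r + x % n) % n) eq) (sym (%-distribˡ-+ b x n)))

-- Adding `m * pred n` subtracts `m` modulo `n`, because together with `m` it makes the multiple
-- `m * n`. Positions can thus be cancelled without truncated subtraction.
[m+i+m*pred[n]]%n≡i%n : ∀ m i n .{{_ : NonZero n}} → (m + i + m * pred n) % n ≡ i % n
[m+i+m*pred[n]]%n≡i%n m i n = trans (cong (_% n) (trans (regroup m i (pred n))
  (cong (λ q → i + m * q) (suc-pred n)))) ([m+kn]%n≡m%n i m n)
  where
  regroup : ∀ m i p → m + i + m * p ≡ i + m * suc p
  regroup m i p = solve (m ∷ i ∷ p ∷ [])

hamiltonian⇒chordedCycle : (G : Graph n) → Cubic G → Hamiltonian G → ChordedCycle G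
hamiltonian⇒chordedCycle {n} G cubic (3≤n , c , along) = record
  { v = v ; ℓ = λ m → proj₁ (third m) ; v-periodic = v-periodic
  ; v-injective = v-injective ; v-surjective = v-surjective ; step = step
  ; chord = λ m → proj₁ (proj₂ (third m))
  ; 2≤ℓ = λ m → proj₁ (proj₂ (proj₂ (third m)))
  ; ℓ+2≤n = λ m → proj₁ (proj₂ (proj₂ (proj₂ (third m))))
  ; neighbours = λ m → proj₂ (proj₂ (proj₂ (proj₂ (third m)))) _
  }
  where
  instance
    _ : NonZero n
    _ = >-nonZero (<-≤-trans z<s 3≤n)

  n₁ = pred n

  n₁<n : n₁ < n
  n₁<n = ≤-reflexive (suc-pred n)

  v : ℕ → Fin n
  v m = c ⟨$⟩ʳ (m mod n)

  v-cong : ∀ {a b} → a % n ≡ b % n → v a ≡ v b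
  v-cong eq = cong (c ⟨$⟩ʳ_) (fromℕ<-cong _ _ eq _ _)

  v-cong⁻¹ : ∀ {a b} → v a ≡ v b → a % n ≡ b % n
  v-cong⁻¹ {a} {b} eq = trans (sym (toℕ-fromℕ< _)) (trans (cong toℕ
    (trans (sym (inverseˡ c)) (trans (cong (c ⟨$⟩ˡ_) eq) (inverseˡ c)))) (toℕ-fromℕ< _))

  v-periodic : ∀ m → v (m + n) ≡ v m
  v-periodic m = v-cong ([m+n]%n≡m%n m n)

  v-injective : ∀ m {i j} → i < n → j < n → v (m + i) ≡ v (m + j) → i ≡ j
  v-injective m {i} {j} i<n j<n eq = begin
    i                        ≡⟨ m<n⇒m%n≡m i<n ⟨
    i % n                   ≡⟨ [m+i+m*pred[n]]%n≡i%n m i n ⟨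
    (m + i + m * n₁) % n    ≡⟨ %-cong-+ʳ (m * n₁) n (v-cong⁻¹ eq) ⟩
    (m + j + m * n₁) % n    ≡⟨ [m+i+m*pred[n]]%n≡i%n m j n ⟩
    j % n                   ≡⟨ m<n⇒m%n≡m j<n ⟩
    j                        ∎
    where open ≡-Reasoning

  v-surjective : ∀ m u → ∃[ j ] j < n × v (m + j) ≡ u
  -- The offset is p - m modulo n, where `p` is the place of `u` on the cycle.
  v-surjective m u = (p + m * n₁) % n , m%n<n (p + m * n₁) n , (begin
    c ⟨$⟩ʳ ((m + (p + m * n₁) % n) mod n)  ≡⟨ v-cong shift ⟩
    c ⟨$⟩ʳ (p mod n)                        ≡⟨ cong (c ⟨$⟩ʳ_) p-mod ⟩
    c ⟨$⟩ʳ (c ⟨$⟩ˡ u)                        ≡⟨ inverseʳ c ⟩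
    u                                        ∎)
    where
    open ≡-Reasoning
    p = toℕ (c ⟨$⟩ˡ u)
    p-mod : p mod n ≡ c ⟨$⟩ˡ u
    p-mod = trans (fromℕ<-cong _ _ (m<n⇒m%n≡m (toℕ<n _)) _ (toℕ<n _)) (fromℕ<-toℕ _ _)
    shift : (m + (p + m * n₁) % n) % n ≡ p % n
    shift = begin
      (m + (p + m * n₁) % n) % n   ≡⟨ cong (_% n) (+-comm m _) ⟩
      ((p + m * n₁) % n + m) % n   ≡⟨ %-cong-+ʳ m n (m%n%n≡m%n (p + m * n₁) n) ⟩
      (p + m * n₁ + m) % n          ≡⟨ cong (_% n) (trans (+-comm (p + m * n₁) m) (sym (+-assoc m p _))) ⟩
      (m + p + m * n₁) % n          ≡⟨ [m+i+m*pred[n]]%n≡i%n m p n ⟩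
      p % n                         ∎

  step : ∀ m → Adj G (v m) (v (suc m))
  step m = subst (Adj G (v m)) (v-cong next-mod) (along (m mod n))
    where
    next-mod : suc (toℕ (m mod n)) % n ≡ suc m % n
    next-mod = begin
      suc (toℕ (m mod n)) % n   ≡⟨ cong (λ r → suc r % n) (toℕ-fromℕ< _) ⟩
      suc (m % n) % n           ≡⟨ cong (_% n) (+-comm 1 (m % n)) ⟩
      (m % n + 1) % n           ≡⟨ %-cong-+ʳ 1 n (m%n%n≡m%n m n) ⟩
      (m + 1) % n                ≡⟨ cong (_% n) (+-comm m 1) ⟩
      suc m % n                  ∎
      where open ≡-Reasoning

  -- Offset 0 would be a loop, and 1 and `n₁` belong to the cycle neighbours, from which the third
  -- neighbour differs. This leaves the offsets from 2 to n - 2.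
  third : ∀ m → ∃[ ℓ ] Adj G (v m) (v (m + ℓ)) × 2 ≤ ℓ × ℓ + 2 ≤ n ×
    (∀ j → j < n → Adj G (v m) (v (m + j)) → j ≡ 1 ⊎ suc j ≡ n ⊎ j ≡ ℓ)
  third m = ℓ , subst (Adj G (v m)) (sym vℓ≡z) z∈ , 2≤ℓ ℓ ℓ≢0 ℓ≢1 , ℓ+2≤n , only′
    where
    1<n : 1 < n
    1<n = <⇒≤ 3≤n

    succ∈ : Adj G (v m) (v (m + 1))
    succ∈ = subst (λ k → Adj G (v m) (v k)) (+-comm 1 m) (step m)

    pred∈ : Adj G (v m) (v (m + n₁))
    pred∈ = N-sym G (subst (Adj G (v (m + n₁)))
      (trans (cong v (trans (sym (+-suc m n₁)) (cong (m +_) (suc-pred n)))) (v-periodic m)) (step (m + n₁)))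

    1≢n₁ : 1 ≢ n₁
    1≢n₁ 1≡n₁ = <-irrefl (trans (cong suc 1≡n₁) (suc-pred n)) 3≤n

    z-spec = third-element (cubic (v m)) succ∈ pred∈ (1≢n₁ ∘ v-injective m 1<n n₁<n)
    z = proj₁ z-spec
    z∈ = proj₁ (proj₂ z-spec)
    z≢succ = proj₁ (proj₂ (proj₂ z-spec))
    z≢pred = proj₁ (proj₂ (proj₂ (proj₂ z-spec)))
    only = proj₂ (proj₂ (proj₂ (proj₂ z-spec)))

    ℓ = proj₁ (v-surjective m z)
    ℓ<n = proj₁ (proj₂ (v-surjective m z))
    vℓ≡z = proj₂ (proj₂ (v-surjective m z))

    ℓ≢0 : ℓ ≢ 0
    ℓ≢0 ℓ≡0 = N-irrefl G (subst (_∈ N G (v m))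
      (trans (sym vℓ≡z) (cong v (trans (cong (m +_) ℓ≡0) (+-identityʳ m)))) z∈)

    ℓ≢1 : ℓ ≢ 1
    ℓ≢1 ℓ≡1 = z≢succ (trans (sym vℓ≡z) (cong (λ k → v (m + k)) ℓ≡1))

    2≤ℓ : ∀ ℓ → ℓ ≢ 0 → ℓ ≢ 1 → 2 ≤ ℓ
    2≤ℓ zero ≢0 ≢1 = contradiction refl ≢0
    2≤ℓ (suc zero) ≢0 ≢1 = contradiction refl ≢1
    2≤ℓ (suc (suc _)) _ _ = s≤s (s≤s z≤n)

    ℓ+2≤n : ℓ + 2 ≤ n
    ℓ+2≤n = subst (_≤ n) (+-comm 2 ℓ) (subst (2 + ℓ ≤_) (suc-pred n) (s≤s (≤∧≢⇒<
      (≤-pred (subst (suc ℓ ≤_) (sym (suc-pred n)) ℓ<n))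
      λ ℓ≡n₁ → z≢pred (trans (sym vℓ≡z) (cong (λ k → v (m + k)) ℓ≡n₁)))))

    only′ : ∀ j → j < n → Adj G (v m) (v (m + j)) → j ≡ 1 ⊎ suc j ≡ n ⊎ j ≡ ℓ
    only′ j j<n adj with only _ adj
    ... | inj₁ eq = inj₁ (v-injective m j<n 1<n eq)
    ... | inj₂ (inj₁ eq) = inj₂ (inj₁ (trans (cong suc (v-injective m j<n n₁<n eq)) (suc-pred n)))
    ... | inj₂ (inj₂ eq) = inj₂ (inj₂ (v-injective m j<n ℓ<n (trans eq (sym vℓ≡z))))

module _ {n : ℕ} {G : Graph n} (C : ChordedCycle G) where

  open ChordedCycle C

  -- The range of `j` excludes both cycle neighbours, so only the chord remains. All later
  -- identifications of chord lengths rest on this.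
  ℓ-unique : ∀ m {j} → 2 ≤ j → j + 2 ≤ n → Adj G (v m) (v (m + j)) → j ≡ ℓ m
  ℓ-unique m {j} 2≤j j+2≤n adj with neighbours m (<-≤-trans (m<m+n j z<s) j+2≤n) adj
  ... | inj₁ refl = contradiction 2≤j (<⇒≱ ≤-refl)
  ... | inj₂ (inj₁ refl) = contradiction j+2≤n (<⇒≱ (≤-reflexive (+-comm 2 j)))
  ... | inj₂ (inj₂ j≡ℓ) = j≡ℓ

  v-shift : ∀ m j → v (m + n + j) ≡ v (m + j)
  v-shift m j = trans (cong v (begin
    m + n + j    ≡⟨ +-assoc m n j ⟩
    m + (n + j)  ≡⟨ cong (m +_) (+-comm n j) ⟩
    m + (j + n)  ≡⟨ +-assoc m j n ⟨
    m + j + n    ∎)) (v-periodic (m + j))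
    where open ≡-Reasoning

  ℓ-periodic : ∀ m → ℓ (m + n) ≡ ℓ m
  ℓ-periodic m = ℓ-unique m (2≤ℓ (m + n)) (ℓ+2≤n (m + n))
    (subst₂ (Adj G) (v-periodic m) (v-shift m (ℓ (m + n))) (chord (m + n)))

  -- From `m + b`, a chord of length n - b closes the circle at `m + n`. Chords that run against the
  -- cycle are expressed in this way.
  chord-back : ∀ m b → b + ℓ (m + b) ≡ n → Adj G (v (m + b)) (v m)
  chord-back m b b+ℓ≡n = subst (Adj G (v (m + b)))
    (trans (cong v (trans (+-assoc m b _) (cong (m +_) b+ℓ≡n))) (v-periodic m)) (chord (m + b))

  ℓ-back : ∀ m b → b + ℓ (m + b) ≡ n → b ≡ ℓ m
  ℓ-back m b b+ℓ≡n = ℓ-unique m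
    (+-cancelʳ-≤ (ℓ (m + b)) 2 b (≤-trans (≤-reflexive (+-comm 2 _))
      (≤-trans (ℓ+2≤n _) (≤-reflexive (sym b+ℓ≡n)))))
    (≤-trans (+-monoʳ-≤ b (2≤ℓ (m + b))) (≤-reflexive b+ℓ≡n))
    (N-sym G (chord-back m b b+ℓ≡n))

  -- A chord cuts the cycle into two arcs, and each of its ends measures one of them.
  ℓ-partner : ∀ m → ℓ m + ℓ (m + ℓ m) ≡ n
  ℓ-partner m = trans (cong (ℓ m +_) (sym b≡ℓ)) (m+[n∸m]≡n ℓ≤n)
    where
    ℓ≤n : ℓ m ≤ n
    ℓ≤n = ≤-trans (m≤m+n _ 2) (ℓ+2≤n m)
    b = n ∸ ℓ m
    b≡ℓ : b ≡ ℓ (m + ℓ m)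
    b≡ℓ = ℓ-unique (m + ℓ m)
      (m+n≤o⇒m≤o∸n 2 (≤-trans (≤-reflexive (+-comm 2 (ℓ m))) (ℓ+2≤n m)))
      (≤-trans (+-monoʳ-≤ b (2≤ℓ m)) (≤-reflexive (m∸n+n≡m ℓ≤n)))
      (subst (Adj G (v (m + ℓ m)))
        (sym (trans (cong v (trans (+-assoc m (ℓ m) b) (cong (m +_) (m+[n∸m]≡n ℓ≤n)))) (v-periodic m)))
        (N-sym G (chord m)))

  step-back : ∀ m → Adj G (v (suc m)) (v m)
  step-back m = N-sym G (step m)

-- The arc constructions all start at `v 0`; rotation carries them to any other place.
rotate : {G : Graph n} → ℕ → ChordedCycle G → ChordedCycle G
rotate {n} {G} r C = record
  { v = λ m → v (r + m)
  ; ℓ = λ m → ℓ (r + m)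
  ; v-periodic = λ m → trans (cong v (sym (+-assoc r m n))) (v-periodic (r + m))
  ; v-injective = λ m i<n j<n eq → v-injective (r + m) i<n j<n
      (trans (cong v (+-assoc r m _)) (trans eq (cong v (sym (+-assoc r m _)))))
  ; v-surjective = λ m u → let j , j<n , eq = v-surjective (r + m) u
                           in j , j<n , trans (cong v (sym (+-assoc r m j))) eq
  ; step = λ m → subst (λ k → Adj G (v (r + m)) (v k)) (sym (+-suc r m)) (step (r + m))
  ; chord = λ m → subst (λ k → Adj G (v (r + m)) (v k)) (+-assoc r m _) (chord (r + m))
  ; 2≤ℓ = λ m → 2≤ℓ (r + m)
  ; ℓ+2≤n = λ m → ℓ+2≤n (r + m)
  ; neighbours = λ m {j} j<n adj → neighbours (r + m) j<n
      (subst (λ k → Adj G (v (r + m)) (v k)) (sym (+-assoc r m j)) adj)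
  }
  where open ChordedCycle C

-- Dense subgraphs made of one or two arcs

HasPDS : Graph n → ℕ → Set
HasPDS G k = ∃[ S ] (ConnectedPDS G S × ∣ S ∣ ≡ k)

-- The summands `2` give each arc two different ends, so that every end has a cycle neighbour in its
-- own arc. Writing the second arc by offsets `e` lets the lemmas on arcs apply to it.
InTwoArcs : ℕ → ℕ → ℕ → Set
InTwoArcs a c m = m < 2 + a ⊎ ∃[ e ] e < 2 + c × m ≡ 3 + a + e

/-mono-cross : ∀ a b p q .{{_ : NonZero p}} .{{_ : NonZero q}} → a * q ≤ b * p →
  (ℤ.+ b) ℚᵘ./ q ℚᵘ.≥ (ℤ.+ a) ℚᵘ./ p
/-mono-cross a b (suc p) (suc q) aq≤bp = ℚᵘ.*≤*
  (subst₂ ℤ._≤_ (ℤ.pos-* a (suc q)) (ℤ.pos-* b (suc p)) (ℤ.+≤+ aq≤bp))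

3k≤1+2n⇒3[k-1]≤2[n-1] : ∀ k n → 2 ≤ k → k < n → 3 * k ≤ 1 + 2 * n → 3 * (k ∸ 1) ≤ 2 * (n ∸ 1)
3k≤1+2n⇒3[k-1]≤2[n-1] (suc k) (suc n) _ _ h = +-cancelˡ-≤ 3 _ _
  (≤-trans (≤-reflexive (sym (*-suc 3 k))) (≤-trans h (≤-reflexive (cong suc (*-suc 2 n)))))

module _ {G : Graph n} (C : ChordedCycle G) where

  open ChordedCycle C

  TwoNeighbours : (ℕ → Set) → ℕ → Set
  TwoNeighbours P m = ∃[ i ] ∃[ j ] (P i × P j × i ≢ j × Adj G (v m) (v i) × Adj G (v m) (v j))

  Link : (ℕ → Set) → ℕ → ℕ → Set
  Link P i j = P i × P j × Adj G (v i) (v j)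

  -- Density and connectivity are reduced to the index predicate `P`, for which arcs are intervals
  -- of numbers. Two neighbours inside suffice since 2/(k - 1) ≥ 3/(n - 1), and any two vertices are
  -- joined through index 0.
  connectedPDS : (P : ℕ → Set) (S : Subset n) →
    (∀ {m} → P m → m < n) → (∀ {m} → P m → v m ∈ S) → (∀ {u} → u ∈ S → ∃[ m ] P m × v m ≡ u) →
    2 ≤ ∣ S ∣ → ∣ S ∣ < n → 3 * ∣ S ∣ ≤ 1 + 2 * n →
    (∀ {m} → P m → TwoNeighbours P m) → (∀ {m} → P m → Star (Link P) m 0) →
    Cubic G → ConnectedPDS G S
  connectedPDS P S P⇒<n P⇒∈ ∈⇒P 2≤∣S∣ ∣S∣<n 3∣S∣≤ twoNeighbours reachable cubic =
    record { 2≤∣S∣ = 2≤∣S∣ ; ∣S∣<n = ∣S∣<n ; dense = dense } , connected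
    where
    2≤d[S] : ∀ {u} → u ∈ S → 2 ≤ d[_] G S u
    2≤d[S] u∈S with ∈⇒P u∈S
    ... | m , Pm , refl with twoNeighbours Pm
    ... | i , j , Pi , Pj , i≢j , adjᵢ , adjⱼ = x∈p∧y∈p⇒2≤∣p∣
      (x∈p∩q⁺ (adjᵢ , P⇒∈ Pi)) (x∈p∩q⁺ (adjⱼ , P⇒∈ Pj)) (i≢j ∘ v-injective 0 (P⇒<n Pi) (P⇒<n Pj))

    instance
      ∣S∣∸1≢0 : NonZero (∣ S ∣ ∸ 1)
      ∣S∣∸1≢0 = >-nonZero (m<n⇒0<n∸m 2≤∣S∣)

      n∸1≢0 : NonZero (n ∸ 1)
      n∸1≢0 = >-nonZero (m<n⇒0<n∸m (<-trans 2≤∣S∣ ∣S∣<n))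

    dense : ∀ {u} → u ∈ S →
      (ℤ.+ d[_] G S u) ℚᵘ./ (∣ S ∣ ∸ 1) ℚᵘ.≥ (ℤ.+ d G u) ℚᵘ./ (n ∸ 1)
    dense {u} u∈S = /-mono-cross (d G u) (d[_] G S u) (n ∸ 1) (∣ S ∣ ∸ 1) (begin
      d G u * (∣ S ∣ ∸ 1)       ≡⟨ cong (_* (∣ S ∣ ∸ 1)) (cubic u) ⟩
      3 * (∣ S ∣ ∸ 1)           ≤⟨ 3k≤1+2n⇒3[k-1]≤2[n-1] ∣ S ∣ n 2≤∣S∣ ∣S∣<n 3∣S∣≤ ⟩
      2 * (n ∸ 1)               ≤⟨ *-monoˡ-≤ (n ∸ 1) (2≤d[S] u∈S) ⟩
      d[_] G S u * (n ∸ 1)      ∎)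
      where open ≤-Reasoning

    walk : ∀ {i j} → Star (Link P) i j → (p : v i ∈ S) (q : v j ∈ S) →
      Star (Induced G S) (v i , p) (v j , q)
    -- Vertices of the induced graph carry membership proofs, so even the empty walk has to identify
    -- two proofs.
    walk ε p q = subst (λ r → Star (Induced G S) (_ , p) (_ , r)) ([]=-irrelevant p q) ε
    walk ((_ , Pj , adj) ◅ links) p q = adj ◅ walk links (P⇒∈ Pj) q

    connected : ConnectedRel (Induced G S)
    connected (u , u∈S) (w , w∈S) with ∈⇒P u∈S | ∈⇒P w∈S
    ... | i , Pi , refl | j , Pj , refl =
      walk (reachable Pi ◅◅ reverse (λ (Px , Py , adj) → Py , Px , N-sym G adj) (reachable Pj)) u∈S w∈S

  -- Adding one vertex at a time on top of any `p` makes the size countable by recursion and allows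
  -- a second arc to be stacked on the first.
  addArc : Subset n → ℕ → ℕ → Subset n
  addArc p s zero    = p
  addArc p s (suc c) = addArc p s c ∪ ⁅ v (s + c) ⁆

  ∈-addArc⁻ : ∀ p s c {u} → u ∈ addArc p s c → u ∈ p ⊎ ∃[ e ] e < c × v (s + e) ≡ u
  ∈-addArc⁻ p s zero u∈ = inj₁ u∈
  ∈-addArc⁻ p s (suc c) u∈ with x∈p∪q⁻ (addArc p s c) _ u∈
  ... | inj₂ u∈⁅⁆ = inj₂ (c , ≤-refl , sym (x∈⁅y⁆⇒x≡y _ u∈⁅⁆))
  ... | inj₁ u∈′ with ∈-addArc⁻ p s c u∈′
  ... | inj₁ u∈p = inj₁ u∈p
  ... | inj₂ (e , e<c , eq) = inj₂ (e , m<n⇒m<1+n e<c , eq)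

  ∈-addArc⁺ˡ : ∀ p s c {u} → u ∈ p → u ∈ addArc p s c
  ∈-addArc⁺ˡ p s zero u∈p = u∈p
  ∈-addArc⁺ˡ p s (suc c) u∈p = x∈p∪q⁺ (inj₁ (∈-addArc⁺ˡ p s c u∈p))

  ∈-addArc⁺ʳ : ∀ p s c {e} → e < c → v (s + e) ∈ addArc p s c
  ∈-addArc⁺ʳ p s (suc c) {e} e<1+c with m<1+n⇒m<n∨m≡n e<1+c
  ... | inj₁ e<c = x∈p∪q⁺ (inj₁ (∈-addArc⁺ʳ p s c e<c))
  ... | inj₂ refl = x∈p∪q⁺ (inj₂ (x∈⁅x⁆ (v (s + e))))

  ∣addArc∣ : ∀ p s c → c ≤ n → (∀ {e} → e < c → v (s + e) ∉ p) → ∣ addArc p s c ∣ ≡ ∣ p ∣ + c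
  ∣addArc∣ p s zero _ _ = sym (+-identityʳ _)
  ∣addArc∣ p s (suc c) c<n fresh = trans (∣p∪⁅x⁆∣≡1+∣p∣ new)
    (trans (cong suc (∣addArc∣ p s c (<⇒≤ c<n) (fresh ∘ m<n⇒m<1+n))) (sym (+-suc ∣ p ∣ c)))
    where
    new : v (s + c) ∉ addArc p s c
    new v∈ with ∈-addArc⁻ p s c v∈
    ... | inj₁ v∈p = fresh ≤-refl v∈p
    ... | inj₂ (e , e<c , eq) = <-irrefl (v-injective s (<-trans e<c c<n) c<n eq) e<c

  -- Inner vertices of an arc keep both cycle neighbours, so only the two ends are left to the
  -- caller.
  arc-twoNeighbours : ∀ P s c → (∀ {e} → e < 2 + c → P (s + e)) →
    TwoNeighbours P s → TwoNeighbours P (s + (1 + c)) → ∀ {e} → e < 2 + c → TwoNeighbours P (s + e)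
  arc-twoNeighbours P s c inP first last {zero} _ = subst (TwoNeighbours P) (sym (+-identityʳ s)) first
  arc-twoNeighbours P s c inP first last {suc e} e<2+c with m<1+n⇒m<n∨m≡n e<2+c
  ... | inj₂ refl = last
  ... | inj₁ e<1+c = s + e , s + (2 + e) , inP (<⇒≤ e<2+c) , inP (s<s e<1+c)
    , (λ eq → <-irrefl (+-cancelˡ-≡ s _ _ eq) (m<n⇒m<1+n ≤-refl))
    , subst (λ m → Adj G (v m) (v (s + e))) (sym (+-suc s e)) (step-back C (s + e))
    , subst (λ m → Adj G (v (s + suc e)) (v m)) (sym (+-suc s (suc e))) (step (s + suc e))

  arc-reachable : ∀ P s c → (∀ {e} → e < c → P (s + e)) → ∀ {e} → e < c → Star (Link P) (s + e) s
  arc-reachable P s c inP {zero} _ = subst (λ m → Star (Link P) m s) (sym (+-identityʳ s)) ε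
  arc-reachable P s c inP {suc e} e<c =
    (inP e<c , inP (<⇒≤ e<c) , subst (λ m → Adj G (v m) (v (s + e))) (sym (+-suc s e)) (step-back C (s + e)))
    ◅ arc-reachable P s c inP (<⇒≤ e<c)

  module _ (cubic : Cubic G) where

    oneArc : ∀ a → 2 + a < n → 3 * (2 + a) ≤ 1 + 2 * n →
      (∃[ j ] j < 2 + a × j ≢ 1 × Adj G (v 0) (v j)) →
      (∃[ j ] j < 2 + a × j ≢ a × Adj G (v (1 + a)) (v j)) →
      HasPDS G (2 + a)
    oneArc a k<n 3k≤ (i , i<k , i≢1 , adjᵢ) (j , j<k , j≢a , adjⱼ) =
      S , connectedPDS (_< 2 + a) S (λ m<k → <-trans m<k k<n) (∈-addArc⁺ʳ ⊥ 0 (2 + a)) sound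
        (subst (2 ≤_) (sym ∣S∣≡k) (s≤s (s≤s z≤n)))
        (subst (_< n) (sym ∣S∣≡k) k<n)
        (subst (λ s → 3 * s ≤ 1 + 2 * n) (sym ∣S∣≡k) 3k≤)
        (arc-twoNeighbours _ 0 a id
          (1 , i , s<s z<s , i<k , i≢1 ∘ sym , step 0 , adjᵢ)
          (a , j , m<n⇒m<1+n ≤-refl , j<k , j≢a ∘ sym , step-back C a , adjⱼ))
        (arc-reachable _ 0 (2 + a) id) cubic
      , ∣S∣≡k
      where
      S = addArc ⊥ 0 (2 + a)

      ∣S∣≡k : ∣ S ∣ ≡ 2 + a
      ∣S∣≡k = trans (∣addArc∣ ⊥ 0 (2 + a) (<⇒≤ k<n) (λ _ → ∉⊥)) (cong (_+ (2 + a)) (∣⊥∣≡0 n))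

      sound : ∀ {u} → u ∈ S → ∃[ m ] m < 2 + a × v m ≡ u
      sound u∈ with ∈-addArc⁻ ⊥ 0 (2 + a) u∈
      ... | inj₁ u∈⊥ = contradiction u∈⊥ ∉⊥
      ... | inj₂ found = found

    -- Only v (2 + a) separates the two arcs, and the chord at v (3 + a) connects them.
    twoArcs : ∀ a c → 5 + a + c ≤ n → 3 * (4 + a + c) ≤ 1 + 2 * n →
      (∃[ j ] InTwoArcs a c j × j ≢ 1 × Adj G (v 0) (v j)) →
      (∃[ j ] InTwoArcs a c j × j ≢ a × Adj G (v (1 + a)) (v j)) →
      (∃[ j ] j < 2 + a × Adj G (v (3 + a)) (v j)) →
      (∃[ j ] InTwoArcs a c j × j ≢ 3 + a + c × Adj G (v (4 + a + c)) (v j)) →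
      HasPDS G (4 + a + c)
    twoArcs a c k<n 3k≤ (i₀ , P₀ , ≢₀ , adj₀) (i₁ , P₁ , ≢₁ , adj₁) (i₂ , i₂<2+a , adj₂) (i₃ , P₃ , ≢₃ , adj₃) =
      S , connectedPDS P S P⇒<n complete sound
        (subst (2 ≤_) (sym ∣S∣≡k) (s≤s (s≤s z≤n)))
        (subst (_< n) (sym ∣S∣≡k) k<n)
        (subst (λ s → 3 * s ≤ 1 + 2 * n) (sym ∣S∣≡k) 3k≤)
        two reach cubic
      , ∣S∣≡k
      where
      P = InTwoArcs a c
      S₁ = addArc ⊥ 0 (2 + a)
      S = addArc S₁ (3 + a) (2 + c)

      P⇒<n : ∀ {m} → P m → m < n
      P⇒<n (inj₁ m<) = <-≤-trans m< (≤-trans (m≤n+m (2 + a) (3 + c)) (≤-trans (≤-reflexive (eq a c)) k<n))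
        where
        eq : ∀ a c → 3 + c + (2 + a) ≡ 5 + a + c
        eq a c = solve (a ∷ c ∷ [])
      P⇒<n (inj₂ (e , e< , refl)) = <-≤-trans (+-monoʳ-< (3 + a) e<) (≤-trans (≤-reflexive (eq a c)) k<n)
        where
        eq : ∀ a c → 3 + a + (2 + c) ≡ 5 + a + c
        eq a c = solve (a ∷ c ∷ [])

      complete : ∀ {m} → P m → v m ∈ S
      complete (inj₁ m<) = ∈-addArc⁺ˡ S₁ (3 + a) (2 + c) (∈-addArc⁺ʳ ⊥ 0 (2 + a) m<)
      complete (inj₂ (e , e< , refl)) = ∈-addArc⁺ʳ S₁ (3 + a) (2 + c) e<

      sound₁ : ∀ {u} → u ∈ S₁ → ∃[ m ] m < 2 + a × v m ≡ u
      sound₁ u∈ with ∈-addArc⁻ ⊥ 0 (2 + a) u∈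
      ... | inj₁ u∈⊥ = contradiction u∈⊥ ∉⊥
      ... | inj₂ found = found

      sound : ∀ {u} → u ∈ S → ∃[ m ] P m × v m ≡ u
      sound u∈ with ∈-addArc⁻ S₁ (3 + a) (2 + c) u∈
      ... | inj₁ u∈S₁ = let m , m< , eq = sound₁ u∈S₁ in m , inj₁ m< , eq
      ... | inj₂ (e , e< , eq) = 3 + a + e , inj₂ (e , e< , refl) , eq

      ∣S∣≡k : ∣ S ∣ ≡ 4 + a + c
      ∣S∣≡k = begin
        ∣ S ∣                        ≡⟨ ∣addArc∣ S₁ (3 + a) (2 + c) 2+c≤n fresh ⟩
        ∣ S₁ ∣ + (2 + c)             ≡⟨ cong (_+ (2 + c)) (∣addArc∣ ⊥ 0 (2 + a) 2+a≤n (λ _ → ∉⊥)) ⟩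
        ∣ ⊥ {n} ∣ + (2 + a) + (2 + c)  ≡⟨ cong (λ z → z + (2 + a) + (2 + c)) (∣⊥∣≡0 n) ⟩
        (2 + a) + (2 + c)            ≡⟨ eq a c ⟩
        4 + a + c                    ∎
        where
        open ≡-Reasoning
        eq : ∀ a c → (2 + a) + (2 + c) ≡ 4 + a + c
        eq a c = solve (a ∷ c ∷ [])
        2+a≤n : 2 + a ≤ n
        2+a≤n = P⇒<n {1 + a} (inj₁ ≤-refl)
        2+c≤n : 2 + c ≤ n
        2+c≤n = ≤-trans (m≤n+m (2 + c) (2 + a)) (≤-trans (≤-reflexive (eq a c)) (<⇒≤ k<n))
        fresh : ∀ {e} → e < 2 + c → v (3 + a + e) ∉ S₁
        fresh {e} e< v∈ with sound₁ v∈
        ... | m , m< , eq′ = <-irrefl (v-injective 0 (P⇒<n (inj₁ m<)) (P⇒<n (inj₂ (e , e< , refl))) eq′)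
          (<-≤-trans m< (≤-trans (n≤1+n (2 + a)) (m≤m+n (3 + a) e)))

      two : ∀ {m} → P m → TwoNeighbours P m
      two (inj₁ m<) = arc-twoNeighbours P 0 a inj₁
        (1 , i₀ , inj₁ (s<s z<s) , P₀ , ≢₀ ∘ sym , step 0 , adj₀)
        (a , i₁ , inj₁ (m<n⇒m<1+n ≤-refl) , P₁ , ≢₁ ∘ sym , step-back C a , adj₁) m<
      two (inj₂ (e , e< , refl)) = arc-twoNeighbours P (3 + a) c (λ e< → inj₂ (_ , e< , refl))
        (4 + a , i₂ , inj₂ (1 , s<s z<s , +-comm 1 (3 + a)) , inj₁ i₂<2+a
          , (λ { refl → <⇒≱ i₂<2+a (≤-trans (n≤1+n _) (n≤1+n _)) }) , step (3 + a) , adj₂)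
        (subst (TwoNeighbours P) (sym (+-suc (3 + a) c))
          (3 + a + c , i₃ , inj₂ (c , m<n⇒m<1+n ≤-refl , refl) , P₃ , ≢₃ ∘ sym
            , step-back C (3 + a + c) , adj₃)) e<

      reach : ∀ {m} → P m → Star (Link P) m 0
      reach (inj₁ m<) = arc-reachable P 0 (2 + a) inj₁ m<
      reach (inj₂ (e , e< , refl)) = arc-reachable P (3 + a) (2 + c) (λ e< → inj₂ (_ , e< , refl)) e<
        ◅◅ (inj₂ (0 , z<s , sym (+-identityʳ (3 + a))) , inj₁ i₂<2+a , adj₂)
        ◅ arc-reachable P 0 (2 + a) inj₁ i₂<2+a

-- Arc conditions in terms of chord lengths

module _ {G : Graph n} (C : ChordedCycle G) where

  open ChordedCycle C

  data ChordEnd (o : ℕ) : Set where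
    chordEnd : ∀ m b → o ≡ m + b → b + ℓ o ≡ n → 2 ≤ b → b ≡ ℓ m → Adj G (v o) (v m) → ChordEnd o

  -- Followed forward, the chord reaches or passes `v n`, which is `v 0`, and hence ends at the
  -- index ℓ o + o - n behind `o`.
  chordEnd-behind : ∀ o → n ≤ ℓ o + o → ChordEnd o
  chordEnd-behind o n≤ℓ+o with m≤n⇒∃[o]m+o≡n n≤ℓ+o
  ... | m , n+m≡ℓ+o = chordEnd m b o≡m+b b+ℓ≡n
      (m+n≤o⇒m≤o∸n 2 (≤-trans (≤-reflexive (+-comm 2 (ℓ o))) (ℓ+2≤n o)))
      (ℓ-back C m b (trans (cong (λ p → b + ℓ p) (sym o≡m+b)) b+ℓ≡n))
      (subst (λ p → Adj G (v p) (v m)) (sym o≡m+b)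
        (chord-back C m b (trans (cong (λ p → b + ℓ p) (sym o≡m+b)) b+ℓ≡n)))
    where
    b = n ∸ ℓ o
    b+ℓ≡n : b + ℓ o ≡ n
    b+ℓ≡n = m∸n+n≡m (≤-trans (m≤m+n _ 2) (ℓ+2≤n o))
    o≡m+b : o ≡ m + b
    o≡m+b = +-cancelˡ-≡ (ℓ o) _ _ (trans (sym n+m≡ℓ+o) (trans (cong (_+ m) (sym b+ℓ≡n)) (regroup b (ℓ o) m)))
      where
      regroup : ∀ b l m → b + l + m ≡ l + (m + b)
      regroup b l m = solve (b ∷ l ∷ m ∷ [])

  module _ (cubic : Cubic G) where

    oneArc-chords : ∀ a → 2 + a < n → 3 * (2 + a) ≤ 1 + 2 * n →
      ℓ 0 < 2 + a → n ≤ ℓ (1 + a) + (1 + a) → HasPDS G (2 + a)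
    oneArc-chords a k<n 3k≤ ℓ₀< back with chordEnd-behind (1 + a) back
    ... | chordEnd m b eq _ 2≤b _ adj = oneArc C cubic a k<n 3k≤
      (ℓ 0 , ℓ₀< , (λ ℓ₀≡1 → <⇒≱ (2≤ℓ 0) (≤-reflexive ℓ₀≡1)) , chord 0)
      (m , s≤s (≤-trans (m≤m+n m b) (≤-reflexive (sym eq)))
        , (λ { refl → <⇒≢ 2≤b (+-cancelˡ-≡ m _ _ (trans (+-comm m 1) eq)) }) , adj)

    inTwoArcs : ∀ a c {m} → m ≤ 4 + a + c → m ≢ 2 + a → InTwoArcs a c m
    inTwoArcs a c {m} m≤ m≢ with <-cmp m (2 + a)
    ... | tri< m<2+a _ _ = inj₁ m<2+a
    ... | tri≈ _ m≡2+a _ = contradiction m≡2+a m≢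
    ... | tri> _ _ m>2+a with m≤n⇒∃[o]m+o≡n m>2+a
    ... | e , refl = inj₂ (e , s≤s (+-cancelˡ-≤ (3 + a) _ _
      (≤-trans m≤ (≤-reflexive (sym (+-suc (3 + a) c))))) , refl)

    -- The chords at `1 + a` and `3 + a` skip the gap because they have length at least 2. Only the
    -- outer ends must be kept away from it: the first by `ℓ 0 ≢ 2 + a`, the last by
    -- `ℓ (2 + a) ≢ 2 + c`, which is stated at the gap itself.
    twoArcs-chords : ∀ a c {k} → 4 + a + c ≡ k → k < n → 3 * k ≤ 1 + 2 * n →
      ℓ 0 ≤ 4 + a + c → ℓ 0 ≢ 2 + a →
      (n ≤ ℓ (1 + a) + (1 + a) ⊎ ℓ (1 + a) ≤ 3 + c) →
      n ≤ ℓ (3 + a) + (3 + a) →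
      n ≤ ℓ (4 + a + c) + (4 + a + c) → ℓ (2 + a) ≢ 2 + c →
      HasPDS G k
    twoArcs-chords a c refl k<n 3k≤ ℓ₀≤ ℓ₀≢ atLast atSecond atEnd ℓ≢
      with chordEnd-behind (3 + a) atSecond | chordEnd-behind (4 + a + c) atEnd
    ... | chordEnd m b eq _ 2≤b _ adj | chordEnd m′ b′ eq′ _ 2≤b′ b′≡ℓ adj′ = twoArcs C cubic a c k<n 3k≤
      (ℓ 0 , inTwoArcs a c ℓ₀≤ ℓ₀≢ , (λ ℓ₀≡1 → <⇒≱ (2≤ℓ 0) (≤-reflexive ℓ₀≡1)) , chord 0)
      (last atLast)
      (m , +-cancelʳ-≤ 2 _ _ (≤-trans (s≤s (+-monoʳ-≤ m 2≤b))
          (≤-reflexive (trans (cong suc (sym eq)) (+-comm 2 (2 + a))))) , adj)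
      (m′ , inTwoArcs a c (≤-trans (m≤m+n m′ b′) (≤-reflexive (sym eq′)))
          (λ { refl → ℓ≢ (trans (sym b′≡ℓ) (sym (+-cancelˡ-≡ (2 + a) _ _ (trans (regroup a c) eq′)))) })
        , (λ { refl → <⇒≢ 2≤b′ (+-cancelˡ-≡ m′ _ _ (trans (+-comm m′ 1) eq′)) }) , adj′)
      where
      regroup : ∀ a c → 2 + a + (2 + c) ≡ 4 + a + c
      regroup a c = solve (a ∷ c ∷ [])

      last : n ≤ ℓ (1 + a) + (1 + a) ⊎ ℓ (1 + a) ≤ 3 + c →
        ∃[ j ] InTwoArcs a c j × j ≢ a × Adj G (v (1 + a)) (v j)
      last (inj₁ back) with chordEnd-behind (1 + a) back
      ... | chordEnd i d eq₁ _ 2≤d _ adj₁ =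
        i , inj₁ (s≤s (≤-trans (m≤m+n i d) (≤-reflexive (sym eq₁))))
          , (λ { refl → <⇒≢ 2≤d (+-cancelˡ-≡ i _ _ (trans (+-comm i 1) eq₁)) }) , adj₁
      last (inj₂ ℓ≤) = 1 + a + ℓ (1 + a)
        , inTwoArcs a c (≤-trans (+-monoʳ-≤ (1 + a) ℓ≤) (≤-reflexive (eq₁ a c)))
          (λ eq₂ → <⇒≢ (2≤ℓ (1 + a)) (sym (+-cancelˡ-≡ (1 + a) _ _ (trans eq₂ (+-comm 1 (1 + a))))))
        , (λ eq₂ → <⇒≢ (m≤m+n (1 + a) _) (sym eq₂)) , chord (1 + a)
        where
        eq₁ : ∀ a c → 1 + a + (3 + c) ≡ 4 + a + c
        eq₁ a c = solve (a ∷ c ∷ [])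

-- Periodic sums and the balance of tails and heads

open Sum +-0-commutativeMonoid using (sum; sum-cong-≗; sum-permute; ∑-distrib-+)

∑< : ℕ → (ℕ → ℕ) → ℕ
∑< n f = sum {n} (f ∘ toℕ)

∑<-+ : ∀ p q f → ∑< (p + q) f ≡ ∑< p f + ∑< q (λ i → f (p + i))
∑<-+ zero q f = refl
∑<-+ (suc p) q f = trans (cong (f 0 +_) (∑<-+ p q (f ∘ suc))) (sym (+-assoc (f 0) _ _))

∑<-periodic : ∀ p q f → (∀ m → f (p + m) ≡ f m) → ∑< (q * p) f ≡ q * ∑< p f
∑<-periodic p zero f _ = refl
∑<-periodic p (suc q) f periodic = trans (∑<-+ p (q * p) f) (cong (∑< p f +_)
  (trans (sum-cong-≗ {q * p} (periodic ∘ toℕ)) (∑<-periodic p q f periodic)))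

∑<-1 : ∀ n → ∑< n (λ _ → 1) ≡ n
∑<-1 zero = refl
∑<-1 (suc n) = cong suc (∑<-1 n)

periodic-+* : ∀ {A : Set} (f : ℕ → A) p → (∀ m → f (m + p) ≡ f m) → ∀ q m → f (m + q * p) ≡ f m
periodic-+* f p periodic zero m = cong f (+-identityʳ m)
periodic-+* f p periodic (suc q) m = trans (cong f (sym (+-assoc m p (q * p))))
  (trans (periodic-+* f p periodic q (m + p)) (periodic m))

periodic-% : ∀ {A : Set} (f : ℕ → A) p .{{_ : NonZero p}} → (∀ m → f (m + p) ≡ f m) → ∀ m → f (m % p) ≡ f m
periodic-% f p periodic m = trans (sym (periodic-+* f p periodic (m / p) (m % p)))
  (cong f (sym (m≡m%n+[m/n]*n m p)))

bit : Bool → ℕ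
bit true  = 1
bit false = 0

bit+bit-not : ∀ x → bit x + bit (not x) ≡ 1
bit+bit-not true = refl
bit+bit-not false = refl

module _ {n : ℕ} {G : Graph n} (C : ChordedCycle G) where

  open ChordedCycle C

  private instance
    n≢0 : NonZero n
    n≢0 = >-nonZero (<-≤-trans z<s (≤-trans (2≤ℓ 0) (≤-trans (m≤m+n _ 2) (ℓ+2≤n 0))))

  partner : Fin n → Fin n
  partner i = (toℕ i + ℓ (toℕ i)) mod n

  partner-involutive : ∀ i → partner (partner i) ≡ i
  partner-involutive i = toℕ-injective (begin
    toℕ (partner (partner i))              ≡⟨ toℕ-fromℕ< _ ⟩
    other (toℕ (partner i))                ≡⟨ cong other (toℕ-fromℕ< _) ⟩
    other (other m)                        ≡⟨ periodic-% other n other-periodic (m + ℓ m) ⟩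
    (m + ℓ m + ℓ (m + ℓ m)) % n            ≡⟨ cong (_% n) (+-assoc m (ℓ m) _) ⟩
    (m + (ℓ m + ℓ (m + ℓ m))) % n          ≡⟨ cong (λ p → (m + p) % n) (ℓ-partner C m) ⟩
    (m + n) % n                            ≡⟨ [m+n]%n≡m%n m n ⟩
    m % n                                  ≡⟨ m<n⇒m%n≡m (toℕ<n i) ⟩
    m                                      ∎)
    where
    open ≡-Reasoning
    m = toℕ i

    other : ℕ → ℕ
    other m = (m + ℓ m) % n

    other-periodic : ∀ m → other (m + n) ≡ other m
    other-periodic m = begin
      (m + n + ℓ (m + n)) % n   ≡⟨ cong (λ l → (m + n + l) % n) (ℓ-periodic C m) ⟩
      (m + n + ℓ m) % n         ≡⟨ %-cong-+ʳ (ℓ m) n ([m+n]%n≡m%n m n) ⟩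
      (m + ℓ m) % n             ∎

  -- Chords form a perfect matching. Adding the sum to its copy permuted by `partner` gives exactly
  -- 1 at every index.
  2*∑<≡n : (P : ℕ → Bool) → (∀ m → P (m + n) ≡ P m) → (∀ m → P (m + ℓ m) ≡ not (P m)) →
    2 * ∑< n (bit ∘ P) ≡ n
  2*∑<≡n P periodic flips = begin
    S + (S + 0)                                        ≡⟨ cong (S +_) (+-identityʳ S) ⟩
    S + S                                              ≡⟨ cong (S +_) (sum-permute (bit ∘ P ∘ toℕ) π) ⟩
    S + sum (bit ∘ P ∘ toℕ ∘ partner)                  ≡⟨ cong (S +_) (sum-cong-≗ {n} (cong bit ∘ flips′)) ⟩
    S + sum {n} (λ i → bit (not (P (toℕ i))))          ≡⟨ ∑-distrib-+ {n} (bit ∘ P ∘ toℕ) (bit ∘ not ∘ P ∘ toℕ) ⟨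
    sum {n} (λ i → bit (P (toℕ i)) + bit (not (P (toℕ i))))
                                                       ≡⟨ sum-cong-≗ {n} (λ i → bit+bit-not (P (toℕ i))) ⟩
    sum {n} (λ _ → 1)                                  ≡⟨ ∑<-1 n ⟩
    n                                                  ∎
    where
    open ≡-Reasoning
    S = ∑< n (bit ∘ P)

    π : Permutation n n
    π = permutation partner partner partner-involutive partner-involutive

    flips′ : ∀ i → P (toℕ (partner i)) ≡ not (P (toℕ i))
    flips′ i = trans (cong P (toℕ-fromℕ< _)) (trans (periodic-% P n periodic _) (flips (toℕ i)))

-- Every chord has length at most n ∸ k in exactly one of its two directions;
-- forward m says that at v m it is the direction of the cycle.
record ShortChords {G : Graph n} (C : ChordedCycle G) (k : ℕ) : Set where
  open ChordedCycle C
  field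
    forward          : ℕ → Bool
    forward-periodic : ∀ m → forward (m + n) ≡ forward m
    forward-flips    : ∀ m → forward (m + ℓ m) ≡ not (forward m)
    forward⇒short    : ∀ m → forward m ≡ true → ℓ m + k ≤ n
    backward⇒long    : ∀ m → forward m ≡ false → k ≤ ℓ m
    forward-shift    : ∀ m → forward (m + (k ∸ 1)) ≡ forward m

rotate-short : ∀ {G : Graph n} {C : ChordedCycle G} {k} r → ShortChords C k → ShortChords (rotate r C) k
rotate-short {C = C} r short = record
  { forward          = λ m → forward (r + m)
  ; forward-periodic = λ m → trans (cong forward (sym (+-assoc r m _))) (forward-periodic (r + m))
  ; forward-flips    = λ m → trans (cong forward (sym (+-assoc r m _))) (forward-flips (r + m))
  ; forward⇒short    = λ m → forward⇒short (r + m)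
  ; backward⇒long    = λ m → backward⇒long (r + m)
  ; forward-shift    = λ m → trans (cong forward (sym (+-assoc r m _))) (forward-shift (r + m))
  }
  where open ShortChords short

-- Consequences of the failure of all single arcs

module _ {G : Graph n} (C : ChordedCycle G) (cubic : Cubic G) where

  open ChordedCycle C

  -- By periodicity finitely many arcs have to be tested. If all fail, `forward` is defined by the
  -- weak bound `ℓ m < k`; the bound n - k is a consequence of the invariance under shifts, and
  -- `n < 2 * k` is what lets the shifts be iterated.
  oneArc⊎shortChords : ∀ {k} → 2 ≤ k → k < n → 3 * k ≤ 1 + 2 * n → n < 2 * k →
    HasPDS G k ⊎ ShortChords C k
  oneArc⊎shortChords (s≤s (s≤s {n = a} z≤n)) k<n 3k≤ n<2k with
    anyUpTo? (λ m → (ℓ m <? 2 + a) ×-dec (n ≤? ℓ (m + (1 + a)) + (1 + a))) n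
  ... | yes (m , _ , ℓ<k , back) = inj₁ (oneArc-chords (rotate m C) cubic a k<n 3k≤
      (subst (λ p → ℓ p < 2 + a) (sym (+-identityʳ m)) ℓ<k) back)
  ... | no none = inj₂ (record
      { forward = forward ; forward-periodic = forward-periodic ; forward-flips = forward-flips
      ; forward⇒short = forward⇒short ; backward⇒long = backward⇒long ; forward-shift = forward-shift })
    where
    k = 2 + a

    forward : ℕ → Bool
    forward m = does (ℓ m <? k)

    forward-periodic : ∀ m → forward (m + n) ≡ forward m
    forward-periodic m = cong (λ l → does (l <? k)) (ℓ-periodic C m)

    <k⇒forward : ∀ {m} → ℓ m < k → forward m ≡ true
    <k⇒forward = dec-true (_ <? k)

    forward⇒<k : ∀ m → forward m ≡ true → ℓ m < k
    forward⇒<k m f with ℓ m <? k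
    ... | yes ℓ<k = ℓ<k
    ... | no ℓ≮k = contradiction (trans (sym f) (dec-false (ℓ m <? k) ℓ≮k)) λ ()

    backward⇒long : ∀ m → forward m ≡ false → k ≤ ℓ m
    backward⇒long m f with ℓ m <? k
    ... | yes ℓ<k = contradiction (trans (sym f) (dec-true (ℓ m <? k) ℓ<k)) λ ()
    ... | no ℓ≮k = ≮⇒≥ ℓ≮k

    instance
      n≢0 : NonZero n
      n≢0 = >-nonZero (≤-<-trans z≤n k<n)

    none′ : ∀ m → ℓ m < k → ℓ (m + (1 + a)) + (1 + a) < n
    none′ m ℓ<k = ≰⇒> λ back → none (m % n , m%n<n m n
      , subst (_< k) (sym (periodic-% ℓ n (ℓ-periodic C) m)) ℓ<k
      , subst (λ l → n ≤ l + (1 + a)) (sym (periodic-% (λ p → ℓ (p + (1 + a))) n shifted m)) back)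
      where
      shifted : ∀ m → ℓ (m + n + (1 + a)) ≡ ℓ (m + (1 + a))
      shifted m = trans (cong ℓ (regroup m n a)) (ℓ-periodic C (m + (1 + a)))
        where
        regroup : ∀ m n a → m + n + (1 + a) ≡ m + (1 + a) + n
        regroup m n a = solve (m ∷ n ∷ a ∷ [])

    shift-short : ∀ m → forward m ≡ true → ℓ (m + (1 + a)) + k ≤ n
    shift-short m f = ≤-trans (≤-reflexive (+-suc _ (1 + a))) (none′ m (forward⇒<k m f))

    short⇒<k : ∀ {l} → l + k ≤ n → l < k
    short⇒<k {l} l+k≤n = +-cancelʳ-≤ k _ _ (≤-trans (s≤s l+k≤n)
      (≤-trans n<2k (≤-reflexive (cong (k +_) (+-identityʳ k)))))

    shift-forward : ∀ m → forward m ≡ true → forward (m + (1 + a)) ≡ true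
    shift-forward m f = <k⇒forward (short⇒<k (shift-short m f))

    shifts-forward : ∀ q m → forward m ≡ true → forward (m + q * (1 + a)) ≡ true
    shifts-forward zero m f = subst (λ p → forward p ≡ true) (sym (+-identityʳ m)) f
    shifts-forward (suc q) m f = subst (λ p → forward p ≡ true) (+-assoc m (1 + a) _)
      (shifts-forward q (m + (1 + a)) (shift-forward m f))

    -- n shifts by k ∸ 1 lead back to the start, so n ∸ 1 of them invert one.
    unshift : ∀ m → m + (1 + a) + pred n * (1 + a) ≡ m + (1 + a) * n
    unshift m = trans (+-assoc m (1 + a) _) (cong (m +_)
      (trans (cong (_* (1 + a)) (suc-pred n)) (*-comm n (1 + a))))

    -- `v m` is the last vertex of the arc that starts k - 1 steps earlier, and that start is
    -- forward too, as `pred n` shifts lead there from `m`.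
    forward⇒short : ∀ m → forward m ≡ true → ℓ m + k ≤ n
    forward⇒short m f = subst (λ l → l + k ≤ n)
      (trans (cong ℓ (trans (regroup m (1 + a) (pred n * (1 + a))) (unshift m)))
        (periodic-+* ℓ n (ℓ-periodic C) (1 + a) m))
      (shift-short (m + pred n * (1 + a)) (shifts-forward (pred n) m f))
      where
      regroup : ∀ m p q → m + q + p ≡ m + p + q
      regroup m p q = solve (m ∷ p ∷ q ∷ [])

    forward-shift : ∀ m → forward (m + (1 + a)) ≡ forward m
    forward-shift m with forward m in eq
    ... | true = shift-forward m eq
    ... | false with forward (m + (1 + a)) in eq′
    ...   | false = refl
    ...   | true = trans (sym (shifts-forward (pred n) (m + (1 + a)) eq′))
              (trans (cong forward (unshift m)) (trans (periodic-+* forward n forward-periodic (1 + a) m) eq))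

    -- Complements to `n` exchange the lengths up to n - k with those from `k` on, and n - k < k
    -- keeps the two ranges apart.
    forward-flips : ∀ m → forward (m + ℓ m) ≡ not (forward m)
    forward-flips m with forward m in eq
    ... | true = dec-false (_ <? k) (≤⇒≯ (+-cancelˡ-≤ (ℓ m) _ _
        (≤-trans (forward⇒short m eq) (≤-reflexive (sym (ℓ-partner C m))))))
    ... | false = <k⇒forward (short⇒<k (≤-trans (+-monoʳ-≤ _ (backward⇒long m eq))
        (≤-reflexive (trans (+-comm _ (ℓ m)) (ℓ-partner C m)))))

-- Naming the difference `d` turns an inequality into an equation for the ring solver.
≤-by : ∀ {x y} d → x + d ≡ y → x ≤ y
≤-by {x} d x+d≡y = ≤-trans (m≤m+n x d) (≤-reflexive x+d≡y)

-- Periods of the pattern and the alternating case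

module _ {G : Graph n} (C : ChordedCycle G) {k : ℕ} (short : ShortChords C k) where

  open ChordedCycle C
  open ShortChords short

  ahead : ∀ {L} → L + k ≡ n → ∀ m → forward m ≡ true → ℓ m ≤ L
  ahead L+k≡n m f = +-cancelʳ-≤ k _ _ (≤-trans (forward⇒short m f) (≤-reflexive (sym L+k≡n)))

  behind : ∀ {L} → L + k ≡ n → ∀ m {e} → forward m ≡ false → L ≤ e → n ≤ ℓ m + e
  behind {L} L+k≡n m {e} f L≤e = begin
    n         ≡⟨ trans (sym L+k≡n) (+-comm L k) ⟩
    k + L     ≤⟨ +-mono-≤ (backward⇒long m f) L≤e ⟩
    ℓ m + e   ∎
    where open ≤-Reasoning

  -- Three shifts by k - 1 fall short of two full rounds by exactly `p` steps.
  forward-period : ∀ p → 1 ≤ k → p + 3 * k ≡ 3 + 2 * n → ∀ m → forward (m + p) ≡ forward m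
  forward-period p 1≤k p+3k≡ m = begin
    forward (m + p)                   ≡⟨ periodic-+* forward (k ∸ 1) forward-shift 3 (m + p) ⟨
    forward (m + p + 3 * (k ∸ 1))     ≡⟨ cong forward (trans (+-assoc m p _) (cong (m +_) eq)) ⟩
    forward (m + 2 * n)               ≡⟨ periodic-+* forward n forward-periodic 2 m ⟩
    forward m                         ∎
    where
    open ≡-Reasoning
    eq : p + 3 * (k ∸ 1) ≡ 2 * n
    eq = +-cancelˡ-≡ 3 _ _ (begin
      3 + (p + 3 * (k ∸ 1))     ≡⟨ regroup p (k ∸ 1) ⟩
      p + 3 * (1 + (k ∸ 1))     ≡⟨ cong (λ j → p + 3 * j) (m+[n∸m]≡n 1≤k) ⟩
      p + 3 * k                 ≡⟨ p+3k≡ ⟩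
      3 + 2 * n                 ∎)
      where
      regroup : ∀ p j → 3 + (p + 3 * j) ≡ p + 3 * (1 + j)
      regroup p j = solve (p ∷ j ∷ [])

  Alternating : Set
  Alternating = ∀ m → forward (suc m) ≡ not (forward m)

  -- Given period 2, two equal consecutive values would make `forward` constant, but every chord
  -- joins different values.
  alternating : (∀ m → forward (m + 2) ≡ forward m) → Alternating
  alternating period₂ m = ¬-not λ eq → not-¬ (constant eq (ℓ m)) (forward-flips m)
    where
    constant : forward (suc m) ≡ forward m → ∀ j → forward (m + j) ≡ forward m
    constant eq zero = cong forward (+-identityʳ m)
    constant eq (suc zero) = trans (cong forward (+-comm m 1)) eq
    constant eq (suc (suc j)) = trans (cong forward (trans (cong (m +_) (+-comm 2 j)) (sym (+-assoc m j 2))))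
      (trans (period₂ (m + j)) (constant eq j))

  module _ (alternates : Alternating) where

    forward-+2* : ∀ e m → forward (m + 2 * e) ≡ forward m
    forward-+2* e m = trans (cong (λ p → forward (m + p)) (*-comm 2 e)) (periodic-+* forward 2
      (λ m → trans (cong forward (+-comm m 2)) (trans (alternates (suc m))
        (trans (cong not (alternates m)) (not-involutive _)))) e m)

    forward-+1+2* : ∀ e m → forward (m + (1 + 2 * e)) ≡ not (forward m)
    forward-+1+2* e m = trans (cong forward (+-suc m (2 * e))) (trans (alternates _) (cong not (forward-+2* e m)))

    ℓ≢2* : ∀ m e → ℓ m ≢ 2 * e
    ℓ≢2* m e ℓ≡ = not-¬ (trans (cong (λ l → forward (m + l)) ℓ≡) (forward-+2* e m)) (forward-flips m)

    ℓ-forward≡3 : 3 + k ≡ n → ∀ m → forward m ≡ true → ℓ m ≡ 3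
    ℓ-forward≡3 3+k≡n m f = ≤-antisym (ahead 3+k≡n m f) (≤∧≢⇒< (2≤ℓ m) (ℓ≢2* m 1 ∘ sym))

    ℓ-backward≡k : 3 + k ≡ n → ∀ e → suc k ≡ 2 * e → ∀ m → forward m ≡ false → ℓ m ≡ k
    ℓ-backward≡k 3+k≡n e 1+k≡2e m f = ≤-antisym
      (≤-pred (≤∧≢⇒< (+-cancelʳ-≤ 2 _ _ (≤-trans (ℓ+2≤n m)
          (≤-reflexive (trans (sym 3+k≡n) (+-comm 2 (1 + k))))))
        (λ ℓ≡1+k → ℓ≢2* m e (trans ℓ≡1+k 1+k≡2e))))
      (backward⇒long m f)

rotate-alternating : ∀ {G : Graph n} (C : ChordedCycle G) {k} (short : ShortChords C k) r →
  Alternating C short → Alternating (rotate r C) (rotate-short r short)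
rotate-alternating C short r alternates m = trans (cong (ShortChords.forward short) (+-suc r m)) (alternates (r + m))

module _ {G : Graph n} (cubic : Cubic G) {k L : ℕ}
  (k<n : k < n) (3k≤ : 3 * k ≤ 1 + 2 * n) (L+k≡n : L + k ≡ n) where

  -- The parities make `0` and the gap `2 + 2 * a` forward and the three other ends backward. The
  -- first chord then has odd length and misses the gap, and the chords of the second arc's ends
  -- reach back far enough. The two last hypotheses are what parity cannot give.
  alternating-twoArcs : (C : ChordedCycle G) (short : ShortChords C k) → Alternating C short →
    let open ChordedCycle C
        open ShortChords short in
    ∀ a c → 4 + 2 * a + (1 + 2 * c) ≡ k → L ≤ 3 + 2 * a → forward 0 ≡ true →
    n ≤ ℓ (1 + 2 * a) + (1 + 2 * a) → ℓ (2 + 2 * a) ≢ 3 + 2 * c → HasPDS G k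
  alternating-twoArcs C short alternates a c size L≤ f₀ atLast ℓ≢ =
    twoArcs-chords C cubic (2 * a) (1 + 2 * c) size k<n 3k≤
      (≤-trans (ahead C short L+k≡n 0 f₀) L≤end)
      (λ ℓ₀≡ → not-¬ (trans (cong forward (trans ℓ₀≡ (sym (*-suc 2 a)))) (even (suc a) 0)) (forward-flips 0))
      (inj₁ atLast)
      (behind C short L+k≡n _ (odd (1 + a) (eq₁ a)) L≤)
      (behind C short L+k≡n _ (odd (2 + a + c) (eq₂ a c)) L≤end)
      ℓ≢
    where
    open ShortChords short
    even = forward-+2* C short alternates
    L≤end : L ≤ 4 + 2 * a + (1 + 2 * c)
    L≤end = ≤-trans L≤ (≤-trans (n≤1+n _) (m≤m+n _ _))
    odd : ∀ e {m} → 1 + 2 * e ≡ m → forward m ≡ false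
    odd e refl = trans (forward-+1+2* C short alternates e 0) (cong not f₀)
    eq₁ : ∀ a → 1 + 2 * (1 + a) ≡ 3 + 2 * a
    eq₁ a = solve (a ∷ [])
    eq₂ : ∀ a c → 1 + 2 * (2 + a + c) ≡ 4 + 2 * a + (1 + 2 * c)
    eq₂ a c = solve (a ∷ c ∷ [])

  -- Here v z is the vertex between the two arcs.
  alternating-twoArcs-around : (C : ChordedCycle G) (short : ShortChords C k) → Alternating C short →
    let open ChordedCycle C
        open ShortChords short in
    ∀ a c d → 4 + 2 * a + (1 + 2 * c) ≡ k → L ≤ 1 + 2 * a → 2 * d + (2 + 2 * a) ≡ n →
    ∀ z → forward z ≡ true → ℓ z ≢ 3 + 2 * c → HasPDS G k
  alternating-twoArcs-around C short alternates a c d size L≤ d+≡n z fz ℓ≢ =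
    alternating-twoArcs C′ short′ alternates′ a c size (≤-trans L≤ (≤-trans (n≤1+n _) (n≤1+n _))) f₀
      (behind C′ short′ L+k≡n _ (trans (forward-+1+2* C′ short′ alternates′ a 0) (cong not f₀)) L≤)
      (λ eq → ℓ≢ (trans
        (sym (trans (cong ℓ (trans (+-assoc z (2 * d) _) (cong (z +_) d+≡n))) (ℓ-periodic C z))) eq))
    where
    open ChordedCycle C
    open ShortChords short
    -- Modulo n this lies `2 + 2 * a` steps before `z`, so the gap falls on `z`; the even distance
    -- keeps the start forward.
    r = z + 2 * d
    C′ = rotate r C
    short′ = rotate-short r short
    alternates′ = rotate-alternating C short r alternates
    f₀ : forward (z + 2 * d + 0) ≡ true
    f₀ = trans (cong forward (+-identityʳ _)) (trans (forward-+2* C short alternates d z) fz)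

3+2s≢5+2s : ∀ s → 3 + 2 * s ≢ 3 + 2 * (1 + s)
3+2s≢5+2s s eq = 1+n≢n (sym (*-cancelˡ-≡ s (1 + s) 2 (+-cancelˡ-≡ 3 _ _ eq)))

-- The size forces a + c = 2 + 2s. The split `2 + s`, `s` fails only at gaps whose chord has length
-- 3 + 2s. If `x` and `z` both have such chords, the split `1 + s`, `1 + s` with gap `x` works: its
-- forbidden length is 5 + 2s, and the chord at `o`, the partner of `z`, leads back exactly to
-- `v 0`.
alternating-14+6s : ∀ s {n k} → n ≡ 14 + 6 * s → k ≡ 9 + 4 * s → {G : Graph n} → Cubic G →
  (C : ChordedCycle G) (short : ShortChords C k) → Alternating C short →
  ShortChords.forward short 0 ≡ true → HasPDS G k
alternating-14+6s s {n} {k} refl refl {G} cubic C short alternates f₀ =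
  decide (ℓ x ≟ 3 + 2 * s) (ℓ z ≟ 3 + 2 * s)
  where
  open ChordedCycle C
  open ShortChords short
  x = 2 + 2 * (1 + s)
  o = 1 + 2 * (1 + s)
  z = o + ℓ o

  k<n : ∀ s → 9 + 4 * s < 14 + 6 * s
  k<n s = ≤-by (4 + 2 * s) (solve (s ∷ []))
  3k≤ : ∀ s → 3 * (9 + 4 * s) ≤ 1 + 2 * (14 + 6 * s)
  3k≤ s = ≤-by 2 (solve (s ∷ []))
  L+k≡n : ∀ s → 5 + 2 * s + (9 + 4 * s) ≡ 14 + 6 * s
  L+k≡n s = solve (s ∷ [])
  size₁ : ∀ s → 4 + 2 * (2 + s) + (1 + 2 * s) ≡ 9 + 4 * s
  size₁ s = solve (s ∷ [])
  size₂ : ∀ s → 4 + 2 * (1 + s) + (1 + 2 * (1 + s)) ≡ 9 + 4 * s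
  size₂ s = solve (s ∷ [])
  L≤₁ : ∀ s → 5 + 2 * s ≤ 1 + 2 * (2 + s)
  L≤₁ s = ≤-by 0 (solve (s ∷ []))
  L≤₂ : ∀ s → 5 + 2 * s ≤ 3 + 2 * (1 + s)
  L≤₂ s = ≤-by 0 (solve (s ∷ []))
  wrap : ∀ s → 2 * (4 + 2 * s) + (2 + 2 * (2 + s)) ≡ 14 + 6 * s
  wrap s = solve (s ∷ [])
  o≡ : ∀ s → 3 + 2 * s ≡ 1 + 2 * (1 + s)
  o≡ s = solve (s ∷ [])

  around : ∀ y → forward y ≡ true → ℓ y ≢ 3 + 2 * s → HasPDS G k
  around = alternating-twoArcs-around cubic (k<n s) (3k≤ s) (L+k≡n s) C short alternates
    (2 + s) s (4 + 2 * s) (size₁ s) (L≤₁ s) (wrap s)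

  forward-x : forward x ≡ true
  forward-x = trans (cong forward (sym (*-suc 2 (1 + s)))) (trans (forward-+2* C short alternates (2 + s) 0) f₀)

  forward-z : forward z ≡ true
  forward-z = trans (forward-flips o) (cong not
    (trans (forward-+1+2* C short alternates (1 + s) 0) (cong not f₀)))

  decide : Dec (ℓ x ≡ 3 + 2 * s) → Dec (ℓ z ≡ 3 + 2 * s) → HasPDS G k
  decide (no ℓx≢) _ = around x forward-x ℓx≢
  decide (yes _) (no ℓz≢) = around z forward-z ℓz≢
  decide (yes ℓx≡) (yes ℓz≡) = alternating-twoArcs cubic (k<n s) (3k≤ s) (L+k≡n s) C short alternates
    (1 + s) (1 + s) (size₂ s) (L≤₂ s) f₀
    (≤-reflexive (trans (sym (ℓ-partner C o)) (cong (ℓ o +_) (trans ℓz≡ (o≡ s)))))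
    (λ ℓx≡′ → 3+2s≢5+2s s (trans (sym ℓx≡) ℓx≡′))

-- Two splits are long enough here, and they forbid different lengths of the chord at the gap, so
-- `v 0` can be removed with one of them.
alternating-16+6s : ∀ s {n k} → n ≡ 16 + 6 * s → k ≡ 11 + 4 * s → {G : Graph n} → Cubic G →
  (C : ChordedCycle G) (short : ShortChords C k) → Alternating C short →
  ShortChords.forward short 0 ≡ true → HasPDS G k
alternating-16+6s s {n} {k} refl refl {G} cubic C short alternates f₀ = decide (ℓ 0 ≟ 3 + 2 * s)
  where
  open ChordedCycle C

  k<n : ∀ s → 11 + 4 * s < 16 + 6 * s
  k<n s = ≤-by (4 + 2 * s) (solve (s ∷ []))
  3k≤ : ∀ s → 3 * (11 + 4 * s) ≤ 1 + 2 * (16 + 6 * s)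
  3k≤ s = ≤-by 0 (solve (s ∷ []))
  L+k≡n : ∀ s → 5 + 2 * s + (11 + 4 * s) ≡ 16 + 6 * s
  L+k≡n s = solve (s ∷ [])
  size₁ : ∀ s → 4 + 2 * (3 + s) + (1 + 2 * s) ≡ 11 + 4 * s
  size₁ s = solve (s ∷ [])
  size₂ : ∀ s → 4 + 2 * (2 + s) + (1 + 2 * (1 + s)) ≡ 11 + 4 * s
  size₂ s = solve (s ∷ [])
  L≤₁ : ∀ s → 5 + 2 * s ≤ 1 + 2 * (3 + s)
  L≤₁ s = ≤-by 2 (solve (s ∷ []))
  L≤₂ : ∀ s → 5 + 2 * s ≤ 1 + 2 * (2 + s)
  L≤₂ s = ≤-by 0 (solve (s ∷ []))
  wrap₁ : ∀ s → 2 * (4 + 2 * s) + (2 + 2 * (3 + s)) ≡ 16 + 6 * s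
  wrap₁ s = solve (s ∷ [])
  wrap₂ : ∀ s → 2 * (5 + 2 * s) + (2 + 2 * (2 + s)) ≡ 16 + 6 * s
  wrap₂ s = solve (s ∷ [])

  decide : Dec (ℓ 0 ≡ 3 + 2 * s) → HasPDS G k
  decide (no ℓ₀≢) = alternating-twoArcs-around cubic (k<n s) (3k≤ s) (L+k≡n s) C short alternates
    (3 + s) s (4 + 2 * s) (size₁ s) (L≤₁ s) (wrap₁ s) 0 f₀ ℓ₀≢
  decide (yes ℓ₀≡) = alternating-twoArcs-around cubic (k<n s) (3k≤ s) (L+k≡n s) C short alternates
    (2 + s) (1 + s) (5 + 2 * s) (size₂ s) (L≤₂ s) (wrap₂ s) 0 f₀ (λ ℓ₀≡′ → 3+2s≢5+2s s (trans (sym ℓ₀≡) ℓ₀≡′))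

-- All chord lengths are forced to be 3 or 7, which defeats both splits that start at a forward
-- vertex. The arcs start at the backward vertex `v 1` instead, whose chord leads to their last
-- vertex `v 8`.
alternating-10 : {G : Graph 10} → Cubic G →
  (C : ChordedCycle G) (short : ShortChords C 7) → Alternating C short →
  ShortChords.forward short 0 ≡ true → HasPDS G 7
alternating-10 cubic C short alternates f₀ = twoArcs-chords (rotate 1 C) cubic 3 0 refl
  (≤-by 2 refl) (≤-by 0 refl)
  (≤-reflexive (ℓ-odd 0)) (λ eq → contradiction (trans (sym (ℓ-odd 0)) eq) λ ())
  (inj₁ (≤-trans (≤-by 1 refl) (≤-reflexive (cong (_+ 4) (sym (ℓ-odd 2))))))
  (≤-trans (≤-by 3 refl) (≤-reflexive (cong (_+ 6) (sym (ℓ-odd 3)))))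
  (≤-reflexive (cong (_+ 7) (sym (ℓ-even 4))))
  (λ eq → contradiction (trans (sym (ℓ-even 3)) eq) λ ())
  where
  open ChordedCycle C
  open ShortChords short
  ℓ-even : ∀ e → ℓ (2 * e) ≡ 3
  ℓ-even e = ℓ-forward≡3 C short alternates refl (2 * e) (trans (forward-+2* C short alternates e 0) f₀)
  ℓ-odd : ∀ e → ℓ (1 + 2 * e) ≡ 7
  ℓ-odd e = ℓ-backward≡k C short alternates refl 4 refl (1 + 2 * e)
    (trans (forward-+1+2* C short alternates e 0) (cong not f₀))

blocks-20+12s : ∀ s {n k} → n ≡ 20 + 12 * s → k ≡ 13 + 8 * s → {G : Graph n} → Cubic G →
  (C : ChordedCycle G) (short : ShortChords C k) → let open ShortChords short in
  (∀ m → forward (m + 4) ≡ forward m) →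
  forward 0 ≡ true → forward 1 ≡ true → forward 2 ≡ false → forward 3 ≡ false → HasPDS G k
blocks-20+12s s {n} {k} refl refl {G} cubic C short period₄ f₀ f₁ f₂ f₃ = decide (ℓ y ≟ 14 + 8 * s)
  where
  open ChordedCycle C
  open ShortChords short
  y = 14 + 8 * s

  forward≡ : ∀ r q {m} → r + q * 4 ≡ m → forward m ≡ forward r
  forward≡ r q refl = periodic-+* forward 4 period₄ q r

  k<n : ∀ s → 13 + 8 * s < 20 + 12 * s
  k<n s = ≤-by (6 + 4 * s) (solve (s ∷ []))
  3k≤ : ∀ s → 3 * (13 + 8 * s) ≤ 1 + 2 * (20 + 12 * s)
  3k≤ s = ≤-by 2 (solve (s ∷ []))
  L+k≡n : ∀ s → 7 + 4 * s + (13 + 8 * s) ≡ 20 + 12 * s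
  L+k≡n s = solve (s ∷ [])

  ℓ≤ : ∀ m → forward m ≡ true → ℓ m ≤ 7 + 4 * s
  ℓ≤ = ahead C short (L+k≡n s)

  n≤ : ∀ m {e} → forward m ≡ false → 7 + 4 * s ≤ e → 20 + 12 * s ≤ ℓ m + e
  n≤ = behind C short (L+k≡n s)

  forward-y : forward y ≡ false
  forward-y = trans (forward≡ 2 (3 + 2 * s) (eq s)) f₂
    where
    eq : ∀ s → 2 + (3 + 2 * s) * 4 ≡ 14 + 8 * s
    eq s = solve (s ∷ [])

  decide : Dec (ℓ y ≡ 14 + 8 * s) → HasPDS G k
  -- The gap is just before `y`. The chord at `y` goes back at most 7 + 4s steps; 7 + 4s would join
  -- two backward vertices and 6 + 4s is excluded here, so it does not pass the start 9 + 4s.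
  decide (no ℓy≢) = twoArcs-chords (rotate (9 + 4 * s) C) cubic (2 + 4 * s) (7 + 4 * s) (size s) (k<n s) (3k≤ s)
    (≤-trans (ℓ≤ _ start) (≤-by (6 + 4 * s) (e₁ s)))
    (λ ℓ≡ → not-¬ (trans (cong (λ l → forward (9 + 4 * s + 0 + l)) ℓ≡)
      (trans (forward≡ 1 (3 + 2 * s) (e₂ s)) (trans f₁ (sym start)))) (forward-flips _))
    (inj₂ (≤-trans (ℓ≤ _ (trans (forward≡ 0 (3 + 2 * s) (e₃ s)) f₀)) (≤-by 3 (e₄ s))))
    (subst (λ p → 20 + 12 * s ≤ ℓ p + (5 + 4 * s)) (e₅ s)
      (≤-trans (≤-reflexive (e₆ s)) (+-monoˡ-≤ (5 + 4 * s) 15+8s≤ℓy)))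
    (n≤ _ (trans (forward≡ 2 (5 + 3 * s) (e₇ s)) f₂) (≤-by (6 + 4 * s) (e₈ s)))
    (λ ℓ≡ → <⇒≱ (≤-by 1 (e₉ s)) (≤-trans (≤-reflexive (sym ℓ≡))
      (ℓ≤ _ (trans (forward≡ 1 (3 + 2 * s) (e₁₀ s)) f₁))))
    where
    size : ∀ s → 4 + (2 + 4 * s) + (7 + 4 * s) ≡ 13 + 8 * s
    size s = solve (s ∷ [])
    start : forward (9 + 4 * s + 0) ≡ true
    start = trans (forward≡ 1 (2 + s) (e s)) f₁
      where
      e : ∀ s → 1 + (2 + s) * 4 ≡ 9 + 4 * s + 0
      e s = solve (s ∷ [])
    e₁ : ∀ s → 7 + 4 * s + (6 + 4 * s) ≡ 4 + (2 + 4 * s) + (7 + 4 * s)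
    e₁ s = solve (s ∷ [])
    e₂ : ∀ s → 1 + (3 + 2 * s) * 4 ≡ 9 + 4 * s + 0 + (2 + (2 + 4 * s))
    e₂ s = solve (s ∷ [])
    e₃ : ∀ s → (3 + 2 * s) * 4 ≡ 9 + 4 * s + (1 + (2 + 4 * s))
    e₃ s = solve (s ∷ [])
    e₄ : ∀ s → 7 + 4 * s + 3 ≡ 3 + (7 + 4 * s)
    e₄ s = solve (s ∷ [])
    e₅ : ∀ s → 14 + 8 * s ≡ 9 + 4 * s + (3 + (2 + 4 * s))
    e₅ s = solve (s ∷ [])
    e₆ : ∀ s → 20 + 12 * s ≡ 15 + 8 * s + (5 + 4 * s)
    e₆ s = solve (s ∷ [])
    e₇ : ∀ s → 2 + (5 + 3 * s) * 4 ≡ 9 + 4 * s + (4 + (2 + 4 * s) + (7 + 4 * s))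
    e₇ s = solve (s ∷ [])
    e₈ : ∀ s → 7 + 4 * s + (6 + 4 * s) ≡ 4 + (2 + 4 * s) + (7 + 4 * s)
    e₈ s = solve (s ∷ [])
    e₉ : ∀ s → suc (7 + 4 * s) + 1 ≡ 2 + (7 + 4 * s)
    e₉ s = solve (s ∷ [])
    e₁₀ : ∀ s → 1 + (3 + 2 * s) * 4 ≡ 9 + 4 * s + (2 + (2 + 4 * s))
    e₁₀ s = solve (s ∷ [])

    ℓy≢13+8s : ℓ y ≢ 13 + 8 * s
    ℓy≢13+8s ℓy≡ = not-¬ (trans (cong (λ l → forward (y + l)) ℓy≡)
      (trans (forward≡ 3 (6 + 4 * s) (e s)) (trans f₃ (sym forward-y)))) (forward-flips y)
      where
      e : ∀ s → 3 + (6 + 4 * s) * 4 ≡ 14 + 8 * s + (13 + 8 * s)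
      e s = solve (s ∷ [])

    15+8s≤ℓy : 15 + 8 * s ≤ ℓ y
    15+8s≤ℓy = ≤∧≢⇒< (≤∧≢⇒< (backward⇒long y forward-y) (ℓy≢13+8s ∘ sym)) (ℓy≢ ∘ sym)
  -- Now `y` is joined to 8 + 4s. With the gap at 9 + 4s these are the last vertices of the two
  -- arcs, so one chord serves both, and the chord at the gap cannot end at `y` as well.
  decide (yes ℓy≡) = twoArcs-chords (rotate 1 C) cubic (6 + 4 * s) (3 + 4 * s) (size s) (k<n s) (3k≤ s)
    (≤-trans (ℓ≤ 1 f₁) (≤-by (6 + 4 * s) (e₁ s)))
    (λ ℓ≡ → <⇒≱ (≤-by 0 (e₂ s)) (≤-trans (≤-reflexive (sym ℓ≡)) (ℓ≤ 1 f₁)))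
    (inj₂ (≤-reflexive (sym (ℓ-back C (8 + 4 * s) (6 + 4 * s)
      (trans (cong (λ p → 6 + 4 * s + ℓ p) (e₃ s)) (trans (cong (6 + 4 * s +_) ℓy≡) (e₄ s)))))))
    (n≤ _ (trans (forward≡ 2 (2 + s) (e₅ s)) f₂) (≤-by 2 (e₆ s)))
    (n≤ _ (trans (cong forward (e₇ s)) forward-y) (≤-by (6 + 4 * s) (e₁ s)))
    (λ ℓ≡ → 19≢20 s (trans (cong₂ _+_ (sym ℓ≡)
        (trans (sym ℓy≡) (cong ℓ (trans (e₈ s) (cong (9 + 4 * s +_) (sym ℓ≡))))))
      (ℓ-partner C (9 + 4 * s))))
    where
    size : ∀ s → 4 + (6 + 4 * s) + (3 + 4 * s) ≡ 13 + 8 * s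
    size s = solve (s ∷ [])
    e₁ : ∀ s → 7 + 4 * s + (6 + 4 * s) ≡ 4 + (6 + 4 * s) + (3 + 4 * s)
    e₁ s = solve (s ∷ [])
    e₂ : ∀ s → suc (7 + 4 * s) + 0 ≡ 2 + (6 + 4 * s)
    e₂ s = solve (s ∷ [])
    e₃ : ∀ s → 8 + 4 * s + (6 + 4 * s) ≡ 14 + 8 * s
    e₃ s = solve (s ∷ [])
    e₄ : ∀ s → 6 + 4 * s + (14 + 8 * s) ≡ 20 + 12 * s
    e₄ s = solve (s ∷ [])
    e₅ : ∀ s → 2 + (2 + s) * 4 ≡ 1 + (3 + (6 + 4 * s))
    e₅ s = solve (s ∷ [])
    e₆ : ∀ s → 7 + 4 * s + 2 ≡ 3 + (6 + 4 * s)
    e₆ s = solve (s ∷ [])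
    e₇ : ∀ s → 1 + (4 + (6 + 4 * s) + (3 + 4 * s)) ≡ 14 + 8 * s
    e₇ s = solve (s ∷ [])
    e₈ : ∀ s → 14 + 8 * s ≡ 9 + 4 * s + (2 + (3 + 4 * s))
    e₈ s = solve (s ∷ [])
    19≢20 : ∀ s → 2 + (3 + 4 * s) + (14 + 8 * s) ≢ 20 + 12 * s
    19≢20 s eq = 1+n≢n (sym (trans (sym (e s)) eq))
      where
      e : ∀ s → 2 + (3 + 4 * s) + (14 + 8 * s) ≡ 19 + 12 * s
      e s = solve (s ∷ [])

-- Recognising the exceptional graphs by their chord lengths

CycleAdj : .{{_ : NonZero n}} → ℕ → Fin n → Fin n → Set
CycleAdj {n} l i j = toℕ j ≡ (toℕ i + 1) % n ⊎ toℕ j ≡ (toℕ i + pred n) % n ⊎ toℕ j ≡ (toℕ i + l) % n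

cycleAdj? : .{{_ : NonZero n}} → ∀ l (i j : Fin n) → Dec (CycleAdj l i j)
cycleAdj? l i j = (_ ≟ _) ⊎-dec ((_ ≟ _) ⊎-dec (_ ≟ _))

module _ {n : ℕ} .{{_ : NonZero n}} {G : Graph n} (C : ChordedCycle G) where

  open ChordedCycle C

  v-% : ∀ m → v (m % n) ≡ v m
  v-% = periodic-% v n v-periodic

  v-≡% : ∀ {j m} → j < n → v j ≡ v m → j ≡ m % n
  v-≡% {j} {m} j<n eq = v-injective 0 j<n (m%n<n m n) (trans eq (sym (v-% m)))

  adj⇔cycleAdj : ∀ i j → Adj G (v (toℕ i)) (v (toℕ j)) ⇔ CycleAdj (ℓ (toℕ i)) i j
  adj⇔cycleAdj i j = mk⇔ to from
    where
    m = toℕ i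

    to : Adj G (v m) (v (toℕ j)) → CycleAdj (ℓ m) i j
    to adj with v-surjective m (v (toℕ j))
    ... | e , e<n , eq with neighbours m e<n (subst (Adj G (v m)) (sym eq) adj)
    ... | inj₁ refl = inj₁ (v-≡% (toℕ<n j) (sym eq))
    ... | inj₂ (inj₁ refl) = inj₂ (inj₁ (v-≡% (toℕ<n j) (sym eq)))
    ... | inj₂ (inj₂ refl) = inj₂ (inj₂ (v-≡% (toℕ<n j) (sym eq)))

    from : CycleAdj (ℓ m) i j → Adj G (v m) (v (toℕ j))
    from (inj₁ eq) = subst (Adj G (v m))
      (trans (cong v (+-comm 1 m)) (sym (trans (cong v eq) (v-% _)))) (step m)
    from (inj₂ (inj₁ eq)) = N-sym G (subst₂ (Adj G)
      (sym (trans (cong v eq) (v-% _)))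
      (trans (cong v (trans (sym (+-suc m (pred n))) (cong (m +_) (suc-pred n)))) (v-periodic m))
      (step (m + pred n)))
    from (inj₂ (inj₂ eq)) = subst (Adj G (v m)) (sym (trans (cong v eq) (v-% _))) (chord m)

  position : Fin n → Fin n
  position u = fromℕ< (proj₁ (proj₂ (v-surjective 0 u)))

  v-position : ∀ u → v (toℕ (position u)) ≡ u
  v-position u = trans (cong v (toℕ-fromℕ< _)) (proj₂ (proj₂ (v-surjective 0 u)))

  position-v : ∀ i → position (v (toℕ i)) ≡ i
  position-v i = toℕ-injective (v-injective 0 (toℕ<n _) (toℕ<n i) (v-position (v (toℕ i))))

  -- Both adjacencies reduce to `CycleAdj` with the same lengths, so sending a vertex to its
  -- position on the cycle is an isomorphism.
  cycle-≅ : (H : Graph n) (l : Fin n → ℕ) → (∀ i → ℓ (toℕ i) ≡ l i) →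
    (∀ i j → Adj H i j ⇔ CycleAdj (l i) i j) → G ≅ H
  cycle-≅ H l ℓ≡l adjH⇔ = permutation position (v ∘ toℕ) position-v v-position , λ u w →
    let open Equivalence
        i = position u
        j = position w
        G⇔ = adj⇔cycleAdj i j
    in mk⇔
      (λ adj → from (adjH⇔ i j) (subst (λ l → CycleAdj l i j) (ℓ≡l i)
        (to G⇔ (subst₂ (Adj G) (sym (v-position u)) (sym (v-position w)) adj))))
      (λ adj → subst₂ (Adj G) (v-position u) (v-position w)
        (from G⇔ (subst (λ l → CycleAdj l i j) (sym (ℓ≡l i)) (to (adjH⇔ i j) adj))))

lengths₁ lengths₂ : Fin 8 → ℕ
lengths₁ = Vec.lookup (2 Vec.∷ 2 Vec.∷ 6 Vec.∷ 6 Vec.∷ 2 Vec.∷ 2 Vec.∷ 6 Vec.∷ 6 Vec.∷ Vec.[])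
lengths₂ = Vec.lookup (3 Vec.∷ 5 Vec.∷ 3 Vec.∷ 5 Vec.∷ 3 Vec.∷ 5 Vec.∷ 3 Vec.∷ 5 Vec.∷ Vec.[])

adj-via-cycleAdj? : (H : Graph 8) (l : Fin 8 → ℕ) →
  Dec (∀ i j → (Adj H i j → CycleAdj (l i) i j) × (CycleAdj (l i) i j → Adj H i j))
adj-via-cycleAdj? H l = all? λ i → all? λ j →
  ((j ∈? N H i) →-dec cycleAdj? (l i) i j) ×-dec (cycleAdj? (l i) i j →-dec (j ∈? N H i))

adjH₁⇔ : ∀ i j → Adj H₁ i j ⇔ CycleAdj (lengths₁ i) i j
adjH₁⇔ i j = let to , from = toWitness {a? = adj-via-cycleAdj? H₁ lengths₁} _ i j in mk⇔ to from

adjH₂⇔ : ∀ i j → Adj H₂ i j ⇔ CycleAdj (lengths₂ i) i j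
adjH₂⇔ i j = let to , from = toWitness {a? = adj-via-cycleAdj? H₂ lengths₂} _ i j in mk⇔ to from

alternating-8⇒≅H₂ : {G : Graph 8} (C : ChordedCycle G) (short : ShortChords C 5) → Alternating C short →
  ShortChords.forward short 0 ≡ true → G ≅ H₂
alternating-8⇒≅H₂ C short alternates f₀ = cycle-≅ C H₂ lengths₂ lengths adjH₂⇔
  where
  open ChordedCycle C
  ℓ-even : ∀ e → ℓ (2 * e) ≡ 3
  ℓ-even e = ℓ-forward≡3 C short alternates refl (2 * e) (trans (forward-+2* C short alternates e 0) f₀)
  ℓ-odd : ∀ e → ℓ (1 + 2 * e) ≡ 5
  ℓ-odd e = ℓ-backward≡k C short alternates refl 3 refl (1 + 2 * e)
    (trans (forward-+1+2* C short alternates e 0) (cong not f₀))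
  lengths : ∀ i → ℓ (toℕ i) ≡ lengths₂ i
  lengths 0F = ℓ-even 0
  lengths 1F = ℓ-odd 0
  lengths 2F = ℓ-even 1
  lengths 3F = ℓ-odd 1
  lengths 4F = ℓ-even 2
  lengths 5F = ℓ-odd 2
  lengths 6F = ℓ-even 3
  lengths 7F = ℓ-odd 3

-- Forward chords have length 2 or 3. From 1, length 3 would lead to the forward vertex 4; from 0,
-- it would lead to 3, which is already the partner of 1.
blocks-8-lengths : {G : Graph 8} (C : ChordedCycle G) (short : ShortChords C 5) →
  let open ShortChords short
      open ChordedCycle C in
  (∀ m → forward (m + 4) ≡ forward m) → forward 0 ≡ true → forward 1 ≡ true →
  ℓ 0 ≡ 2 × ℓ 1 ≡ 2 × ℓ 2 ≡ 6 × ℓ 3 ≡ 6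
blocks-8-lengths C short period₄ f₀ f₁ = ℓ₀≡2 , ℓ₁≡2 , ℓ-end 0 ℓ₀≡2 , ℓ-end 1 ℓ₁≡2
  where
  open ChordedCycle C
  open ShortChords short

  2or3 : ∀ m → forward m ≡ true → ℓ m ≢ 3 → ℓ m ≡ 2
  2or3 m f ℓ≢3 = ≤-antisym (≤-pred (≤∧≢⇒< (ahead C short refl m f) ℓ≢3)) (2≤ℓ m)

  ℓ-end : ∀ m → ℓ m ≡ 2 → ℓ (2 + m) ≡ 6
  ℓ-end m ℓ≡2 = +-cancelˡ-≡ 2 _ _ (trans (cong₂ (λ l p → l + ℓ p) (sym ℓ≡2)
    (trans (+-comm 2 m) (cong (m +_) (sym ℓ≡2)))) (ℓ-partner C m))

  ℓ₁≡2 : ℓ 1 ≡ 2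
  ℓ₁≡2 = 2or3 1 f₁ λ ℓ₁≡3 → not-¬ (trans (cong (λ l → forward (1 + l)) ℓ₁≡3)
    (trans (period₄ 0) (trans f₀ (sym f₁)))) (forward-flips 1)

  ℓ₀≡2 : ℓ 0 ≡ 2
  ℓ₀≡2 = 2or3 0 f₀ λ ℓ₀≡3 → contradiction
    (trans (cong₂ _+_ (sym ℓ₀≡3) (trans (sym (ℓ-end 1 ℓ₁≡2)) (cong ℓ (sym ℓ₀≡3)))) (ℓ-partner C 0)) λ ()

blocks-8⇒≅H₁ : {G : Graph 8} (C : ChordedCycle G) (short : ShortChords C 5) → let open ShortChords short in
  (∀ m → forward (m + 4) ≡ forward m) → forward 0 ≡ true → forward 1 ≡ true → G ≅ H₁
blocks-8⇒≅H₁ C short period₄ f₀ f₁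
  with blocks-8-lengths C short period₄ f₀ f₁
     | blocks-8-lengths (rotate 4 C) (rotate-short 4 short) (λ m → period₄ (4 + m))
         (trans (period₄ 0) f₀) (trans (period₄ 1) f₁)
... | ℓ₀ , ℓ₁ , ℓ₂ , ℓ₃ | ℓ₄ , ℓ₅ , ℓ₆ , ℓ₇ = cycle-≅ C H₁ lengths₁ lengths adjH₁⇔
  where
  lengths : ∀ i → ChordedCycle.ℓ C (toℕ i) ≡ lengths₁ i
  lengths 0F = ℓ₀
  lengths 1F = ℓ₁
  lengths 2F = ℓ₂
  lengths 3F = ℓ₃
  lengths 4F = ℓ₄
  lengths 5F = ℓ₅
  lengths 6F = ℓ₆
  lengths 7F = ℓ₇

-- The residues of n modulo 6

2*m≢3 : ∀ m → 2 * m ≢ 3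
2*m≢3 (suc (suc m)) eq = contradiction (trans (sym (*-distribˡ-+ 2 2 m)) eq) λ ()

period₄⇒period₂ : (f : ℕ → Bool) → (∀ m → f (m + 4) ≡ f m) → f 2 ≡ f 0 → f 3 ≡ f 1 → ∀ m → f (m + 2) ≡ f m
period₄⇒period₂ f period₄ f₂≡f₀ f₃≡f₁ zero = f₂≡f₀
period₄⇒period₂ f period₄ f₂≡f₀ f₃≡f₁ (suc zero) = f₃≡f₁
period₄⇒period₂ f period₄ f₂≡f₀ f₃≡f₁ (suc (suc m)) = begin
  f (2 + m + 2)   ≡⟨ cong f (trans (cong (2 +_) (+-comm m 2)) (+-comm 4 m)) ⟩
  f (m + 4)       ≡⟨ period₄ m ⟩
  f m             ≡⟨ period₄⇒period₂ f period₄ f₂≡f₀ f₃≡f₁ m ⟨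
  f (m + 2)       ≡⟨ cong f (+-comm m 2) ⟩
  f (2 + m)       ∎
  where open ≡-Reasoning

-- Exactly two of the four values are true. If they are opposite in the period, it halves; if they
-- are adjacent, `r` is where their block begins.
balanced-period₄ : (f : ℕ → Bool) → (∀ m → f (m + 4) ≡ f m) → 2 * ∑< 4 (bit ∘ f) ≡ 4 →
  (∀ m → f (m + 2) ≡ f m) ⊎ ∃[ r ] f r ≡ true × f (r + 1) ≡ true × f (r + 2) ≡ false × f (r + 3) ≡ false
balanced-period₄ f period₄ balanced with f 0 in f₀ | f 1 in f₁ | f 2 in f₂ | f 3 in f₃
... | true | true | false | false = inj₂ (0 , f₀ , f₁ , f₂ , f₃)
... | false | true | true | false = inj₂ (1 , f₁ , f₂ , f₃ , trans (period₄ 0) f₀)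
... | false | false | true | true = inj₂ (2 , f₂ , f₃ , trans (period₄ 0) f₀ , trans (period₄ 1) f₁)
... | true | false | false | true = inj₂ (3 , f₃ , trans (period₄ 0) f₀ , trans (period₄ 1) f₁ , trans (period₄ 2) f₂)
... | true | false | true | false = inj₁ (period₄⇒period₂ f period₄ (trans f₂ (sym f₀)) (trans f₃ (sym f₁)))
... | false | true | false | true = inj₁ (period₄⇒period₂ f period₄ (trans f₂ (sym f₀)) (trans f₃ (sym f₁)))
balanced-period₄ f period₄ () | true | true | true | true
balanced-period₄ f period₄ () | true | true | false | true
balanced-period₄ f period₄ () | false | false | true | false
balanced-period₄ f period₄ () | false | false | false | false

module _ {n : ℕ} {G : Graph n} (cubic : Cubic G) (≇H₁ : ¬ (G ≅ H₁)) (≇H₂ : ¬ (G ≅ H₂)) where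

  alternating-2+6q : ∀ q {k} → n ≡ 2 + 6 * q → k ≡ 1 + 4 * q → (C : ChordedCycle G) (short : ShortChords C k) →
    Alternating C short → ShortChords.forward short 0 ≡ true → HasPDS G k
  alternating-2+6q zero refl _ C _ _ _ =
    contradiction (≤-trans (+-monoˡ-≤ 2 (ChordedCycle.2≤ℓ C 0)) (ChordedCycle.ℓ+2≤n C 0)) λ { (s≤s (s≤s ())) }
  alternating-2+6q (suc zero) refl refl C short alternates f₀ =
    contradiction (alternating-8⇒≅H₂ C short alternates f₀) ≇H₂
  alternating-2+6q (suc (suc s)) n≡ k≡ = alternating-14+6s s (trans n≡ (e₁ s)) (trans k≡ (e₂ s)) cubic
    where
    e₁ : ∀ s → 2 + 6 * (2 + s) ≡ 14 + 6 * s
    e₁ s = solve (s ∷ [])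
    e₂ : ∀ s → 1 + 4 * (2 + s) ≡ 9 + 4 * s
    e₂ s = solve (s ∷ [])

  alternating-4+6q : ∀ q {k} → n ≡ 4 + 6 * q → k ≡ 3 + 4 * q → (C : ChordedCycle G) (short : ShortChords C k) →
    Alternating C short → ShortChords.forward short 0 ≡ true → HasPDS G k
  -- On four vertices n - k is 1, too short for any chord.
  alternating-4+6q zero refl refl C short _ f₀ =
    contradiction (≤-trans (ChordedCycle.2≤ℓ C 0) (ahead C short {L = 1} refl 0 f₀)) λ { (s≤s ()) }
  alternating-4+6q (suc zero) refl refl = alternating-10 cubic
  alternating-4+6q (suc (suc s)) n≡ k≡ = alternating-16+6s s (trans n≡ (e₁ s)) (trans k≡ (e₂ s)) cubic
    where
    e₁ : ∀ s → 4 + 6 * (2 + s) ≡ 16 + 6 * s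
    e₁ s = solve (s ∷ [])
    e₂ : ∀ s → 3 + 4 * (2 + s) ≡ 11 + 4 * s
    e₂ s = solve (s ∷ [])

  blocks-8+12j : ∀ j {k} → n ≡ 8 + 12 * j → k ≡ 5 + 8 * j → (C : ChordedCycle G) (short : ShortChords C k) →
    let open ShortChords short in
    (∀ m → forward (m + 4) ≡ forward m) →
    forward 0 ≡ true → forward 1 ≡ true → forward 2 ≡ false → forward 3 ≡ false → HasPDS G k
  blocks-8+12j zero refl refl C short period₄ f₀ f₁ _ _ =
    contradiction (blocks-8⇒≅H₁ C short period₄ f₀ f₁) ≇H₁
  blocks-8+12j (suc s) n≡ k≡ = blocks-20+12s s (trans n≡ (e₁ s)) (trans k≡ (e₂ s)) cubic
    where
    e₁ : ∀ s → 8 + 12 * (1 + s) ≡ 20 + 12 * s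
    e₁ s = solve (s ∷ [])
    e₂ : ∀ s → 5 + 8 * (1 + s) ≡ 13 + 8 * s
    e₂ s = solve (s ∷ [])

  module _ (C : ChordedCycle G) {k : ℕ} (short : ShortChords C k) where

    open ChordedCycle C
    open ShortChords short

    starting-forward : ((C : ChordedCycle G) (short : ShortChords C k) → Alternating C short →
      ShortChords.forward short 0 ≡ true → HasPDS G k) → (∀ m → forward (m + 2) ≡ forward m) → HasPDS G k
    starting-forward found period₂ with forward 0 in f₀
    ... | true = found C short (alternating C short period₂) f₀
    ... | false = found (rotate 1 C) (rotate-short 1 short)
      (rotate-alternating C short 1 (alternating C short period₂))
      (trans (alternating C short period₂ 0) (cong not f₀))

    -- The cycle consists of `suc q` whole periods, so its balance descends to a single one.
    2*∑<p≡p : ∀ p q → n ≡ suc q * p → (∀ m → forward (m + p) ≡ forward m) → 2 * ∑< p (bit ∘ forward) ≡ p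
    2*∑<p≡p p q n≡ periodic = *-cancelˡ-≡ _ _ (suc q) (begin
      suc q * (2 * ∑< p f)   ≡⟨ swap (suc q) (∑< p f) ⟩
      2 * (suc q * ∑< p f)   ≡⟨ cong (2 *_) (∑<-periodic p (suc q) f f-periodic) ⟨
      2 * ∑< (suc q * p) f   ≡⟨ cong (λ n → 2 * ∑< n f) n≡ ⟨
      2 * ∑< n f             ≡⟨ 2*∑<≡n C forward forward-periodic forward-flips ⟩
      n                      ≡⟨ n≡ ⟩
      suc q * p              ∎)
      where
      open ≡-Reasoning
      f = bit ∘ forward
      f-periodic : ∀ m → f (p + m) ≡ f m
      f-periodic m = cong bit (trans (cong forward (+-comm p m)) (periodic m))
      swap : ∀ q s → q * (2 * s) ≡ 2 * (q * s)
      swap q s = solve (q ∷ s ∷ [])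

    hasPDS-6q : ∀ q → n ≡ 6 * q → k ≡ 4 * q → HasPDS G k
    hasPDS-6q zero refl _ = contradiction (≤-trans (2≤ℓ 0) (≤-trans (m≤m+n _ 2) (ℓ+2≤n 0))) λ ()
    hasPDS-6q (suc q) n≡ k≡ = contradiction
      (2*∑<p≡p 3 (1 + 2 * q) (trans n≡ (e₁ q)) (forward-period C short 3
        (subst (1 ≤_) (sym k≡) (s≤s z≤n))
        (trans (cong (λ k → 3 + 3 * k) k≡) (trans (e₂ q) (cong (λ n → 3 + 2 * n) (sym n≡))))))
      (2*m≢3 (∑< 3 (bit ∘ forward)))
      where
      e₁ : ∀ q → 6 * suc q ≡ (2 + 2 * q) * 3
      e₁ q = solve (q ∷ [])
      e₂ : ∀ q → 3 + 3 * (4 * suc q) ≡ 3 + 2 * (6 * suc q)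
      e₂ q = solve (q ∷ [])

    hasPDS-4+6q : ∀ q → n ≡ 4 + 6 * q → k ≡ 3 + 4 * q → HasPDS G k
    hasPDS-4+6q q n≡ k≡ = starting-forward (alternating-4+6q q n≡ k≡) (forward-period C short 2
      (subst (1 ≤_) (sym k≡) (s≤s z≤n))
      (trans (cong (λ k → 2 + 3 * k) k≡) (trans (e q) (cong (λ n → 3 + 2 * n) (sym n≡)))))
      where
      e : ∀ q → 2 + 3 * (3 + 4 * q) ≡ 3 + 2 * (4 + 6 * q)
      e q = solve (q ∷ [])

    -- The pattern has period gcd(4, n). For even `q` this is 2; for odd `q` it is 4, and balance
    -- over four indices separates alternation from blocks of two.
    hasPDS-2+6q : ∀ q → n ≡ 2 + 6 * q → k ≡ 1 + 4 * q → HasPDS G k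
    hasPDS-2+6q q n≡ k≡ = byParity (q divMod 2)
      where
      period₄ : ∀ m → forward (m + 4) ≡ forward m
      period₄ = forward-period C short 4 (subst (1 ≤_) (sym k≡) (s≤s z≤n))
        (trans (cong (λ k → 4 + 3 * k) k≡) (trans (e q) (cong (λ n → 3 + 2 * n) (sym n≡))))
        where
        e : ∀ q → 4 + 3 * (1 + 4 * q) ≡ 3 + 2 * (2 + 6 * q)
        e q = solve (q ∷ [])

      byParity : DivMod q 2 → HasPDS G k
      byParity (result j 0F q≡) = starting-forward (alternating-2+6q q n≡ k≡) λ m → begin
        forward (m + 2)               ≡⟨ periodic-+* forward 4 period₄ (3 * j) (m + 2) ⟨
        forward (m + 2 + 3 * j * 4)   ≡⟨ cong forward (trans (e m j) (cong (m +_) (sym n≡2+6q))) ⟩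
        forward (m + n)               ≡⟨ forward-periodic m ⟩
        forward m                     ∎
        where
        open ≡-Reasoning
        n≡2+6q : n ≡ 2 + 6 * (j * 2)
        n≡2+6q = trans n≡ (cong (λ q → 2 + 6 * q) q≡)
        e : ∀ m j → m + 2 + 3 * j * 4 ≡ m + (2 + 6 * (j * 2))
        e m j = solve (m ∷ j ∷ [])
      byParity (result j 1F q≡) with balanced-period₄ forward period₄
        (2*∑<p≡p 4 (1 + 3 * j) (trans n≡ (trans (cong (λ q → 2 + 6 * q) q≡) (e j))) period₄)
        where
        e : ∀ j → 2 + 6 * (1 + j * 2) ≡ (2 + 3 * j) * 4
        e j = solve (j ∷ [])
      ... | inj₁ period₂ = starting-forward (alternating-2+6q q n≡ k≡) period₂
      ... | inj₂ (r , f₀ , f₁ , f₂ , f₃) = blocks-8+12j j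
        (trans n≡ (trans (cong (λ q → 2 + 6 * q) q≡) (e₁ j)))
        (trans k≡ (trans (cong (λ q → 1 + 4 * q) q≡) (e₂ j)))
        (rotate r C) (rotate-short r short)
        (λ m → trans (cong forward (sym (+-assoc r m 4))) (period₄ (r + m)))
        (trans (cong forward (+-identityʳ r)) f₀) f₁ f₂ f₃
        where
        e₁ : ∀ j → 2 + 6 * (1 + j * 2) ≡ 8 + 12 * j
        e₁ j = solve (j ∷ [])
        e₂ : ∀ j → 1 + 4 * (1 + j * 2) ≡ 5 + 8 * j
        e₂ j = solve (j ∷ [])

  [r+k*3]/3≡k : ∀ (r : Fin 3) k → (toℕ r + k * 3) / 3 ≡ k
  [r+k*3]/3≡k r k = trans (+-distrib-/-∣ʳ (toℕ r) (divides k refl))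
    (cong₂ _+_ (m<n⇒m/n≡0 (toℕ<n r)) (m*n/n≡m k 3))

  -- Balance makes `n` twice the number of tails, so that number modulo 3 determines `n` modulo 6
  -- and removes the rounding from the size.
  short⇒hasPDS : (C : ChordedCycle G) → ShortChords C ((2 * n + 1) / 3) → HasPDS G ((2 * n + 1) / 3)
  short⇒hasPDS C short = byResidue (∑< n (bit ∘ forward) divMod 3)
    where
    open ShortChords short
    n≡2* : ∀ {S} → ∑< n (bit ∘ forward) ≡ S → n ≡ 2 * S
    n≡2* eq = trans (sym (2*∑<≡n C forward forward-periodic forward-flips)) (cong (2 *_) eq)

    k≡ : ∀ {m} r k → n ≡ m → 2 * m + 1 ≡ toℕ {3} r + k * 3 → (2 * n + 1) / 3 ≡ k
    k≡ r k refl eq = trans (cong (_/ 3) eq) ([r+k*3]/3≡k r k)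

    byResidue : DivMod (∑< n (bit ∘ forward)) 3 → HasPDS G ((2 * n + 1) / 3)
    byResidue (result q 0F eq) = hasPDS-6q C short q n≡6q (k≡ 1F (4 * q) n≡6q (e₂ q))
      where
      e₁ : ∀ q → 2 * (q * 3) ≡ 6 * q
      e₁ q = solve (q ∷ [])
      n≡6q = trans (n≡2* eq) (e₁ q)
      e₂ : ∀ q → 2 * (6 * q) + 1 ≡ 1 + 4 * q * 3
      e₂ q = solve (q ∷ [])
    byResidue (result q 1F eq) = hasPDS-2+6q C short q n≡2+6q (k≡ 2F (1 + 4 * q) n≡2+6q (e₂ q))
      where
      e₁ : ∀ q → 2 * (1 + q * 3) ≡ 2 + 6 * q
      e₁ q = solve (q ∷ [])
      n≡2+6q = trans (n≡2* eq) (e₁ q)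
      e₂ : ∀ q → 2 * (2 + 6 * q) + 1 ≡ 2 + (1 + 4 * q) * 3
      e₂ q = solve (q ∷ [])
    byResidue (result q 2F eq) = hasPDS-4+6q C short q n≡4+6q (k≡ 0F (3 + 4 * q) n≡4+6q (e₂ q))
      where
      e₁ : ∀ q → 2 * (2 + q * 3) ≡ 4 + 6 * q
      e₁ q = solve (q ∷ [])
      n≡4+6q = trans (n≡2* eq) (e₁ q)
      e₂ : ∀ q → 2 * (4 + 6 * q) + 1 ≡ 0 + (3 + 4 * q) * 3
      e₂ q = solve (q ∷ [])

-- Bounds for the size and the conclusion

3*[m/3]≤m : ∀ m → 3 * (m / 3) ≤ m
3*[m/3]≤m m = ≤-trans (≤-reflexive (*-comm 3 (m / 3))) (m/n*n≤m m 3)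

m<3+3*[m/3] : ∀ m → m < 3 + 3 * (m / 3)
m<3+3*[m/3] m = subst (_< 3 + 3 * (m / 3)) (sym (m≡m%n+[m/n]*n m 3))
  (+-mono-<-≤ (m%n<n m 3) (≤-reflexive (*-comm (m / 3) 3)))

-- n = 4 is special: 2 * n + 1 is then a multiple of 3, and rounding costs nothing.
n<2*⌊[2n+1]/3⌋ : ∀ n → 4 ≤ n → n < 2 * ((2 * n + 1) / 3)
n<2*⌊[2n+1]/3⌋ n 4≤n with m≤n⇒m<n∨m≡n 4≤n
... | inj₂ refl = ≤-by 1 refl
-- From 3k ≥ 2n - 1 follows 6k ≥ 4n - 2, and this is at least 3(n + 1) once n ≥ 5.
... | inj₁ 5≤n = *-cancelˡ-≤ 3 (+-cancelʳ-≤ (n + 2 * (2 + 3 * k)) _ _ (begin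
  3 * suc n + (n + 2 * (2 + 3 * k))   ≡⟨ balance n k ⟩
  3 * (2 * k) + (5 + 2 * (2 * n + 1)) ≤⟨ +-monoʳ-≤ (3 * (2 * k)) (+-mono-≤ 5≤n (*-monoʳ-≤ 2 2n+1≤2+3k)) ⟩
  3 * (2 * k) + (n + 2 * (2 + 3 * k)) ∎))
  where
  open ≤-Reasoning
  k = (2 * n + 1) / 3
  2n+1≤2+3k : 2 * n + 1 ≤ 2 + 3 * k
  2n+1≤2+3k = ≤-pred (m<3+3*[m/3] (2 * n + 1))
  balance : ∀ n k → 3 * suc n + (n + 2 * (2 + 3 * k)) ≡ 3 * (2 * k) + (5 + 2 * (2 * n + 1))
  balance n k = solve (n ∷ k ∷ [])

theorem5 : (n : ℕ) (G : Graph n) → Connected G → Cubic G → Hamiltonian G →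
    ¬ (G ≅ H₁) → ¬ (G ≅ H₂) →
    ∃[ S ] (ConnectedPDS G S × ∣ S ∣ ≡ (2 * n + 1) / 3)
theorem5 n G _ cubic hamiltonian ≇H₁ ≇H₂ =
  [ id , short⇒hasPDS cubic ≇H₁ ≇H₂ C ]′ (oneArc⊎shortChords C cubic 2≤k k<n 3k≤1+2n n<2k)
  where
  C = hamiltonian⇒chordedCycle G cubic hamiltonian
  open ChordedCycle C
  k = (2 * n + 1) / 3

  4≤n : 4 ≤ n
  4≤n = ≤-trans (+-monoˡ-≤ 2 (2≤ℓ 0)) (ℓ+2≤n 0)

  n<2k : n < 2 * k
  n<2k = n<2*⌊[2n+1]/3⌋ n 4≤n

  2≤k : 2 ≤ k
  2≤k = *-cancelˡ-≤ 2 (≤-trans 4≤n (<⇒≤ n<2k))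

  3k≤1+2n : 3 * k ≤ 1 + 2 * n
  3k≤1+2n = ≤-trans (3*[m/3]≤m (2 * n + 1)) (≤-reflexive (+-comm (2 * n) 1))

  k<n : k < n
  k<n = *-cancelˡ-< 3 _ _ (≤-<-trans 3k≤1+2n (+-monoˡ-< (2 * n) (<-≤-trans (s≤s (s≤s z≤n)) 4≤n)))
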